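{- Let $\mathfrak{k}=(K_{\mathfrak{k}},\le_{\mathfrak{k}})$ be an abstract elementary class. If $\mu$ is a strong limit cardinal and $\mathrm{cf}(\mu)>\mathrm{LST}_{\mathfrak{k}}$ is a measurable cardinal, then $\mathfrak{k}$ has $(\mu,\mathrm{cf}(\mu))$-amalgamation bases, i.e. the $\mathrm{cf}(\mu)$-majority of $M\in K^{\mathfrak{k}}_\mu$ are amalgamation bases.
   Context: $\mathfrak{k}=(K_{\mathfrak{k}},\le_{\mathfrak{k}})$ is an abstract elementary class (a.e.c.) in a vocabulary $\tau_{\mathfrak{k}}$; an empty model, which is $\le_{\mathfrak{k}}$ every member, is allowed. $\mathrm{LST}_{\mathfrak{k}}$ is its Löwenheim–Skolem–Tarski number (taken to be $\ge|\tau_{\mathfrak{k}}|+\aleph_0$). $K^{\mathfrak{k}}_\lambda=\{M\in K_{\mathfrak{k}}:\|M\|=\lambda\}$. $M_0\in K^{\mathfrak{k}}_\lambda$ is an amalgamation base if whenever $M_0\le_{\mathfrak{k}}M_\ell\in K^{\mathfrak{k}}_\lambda$ for $\ell=1,2$, there is $M_3\in K_{\mathfrak{k}}$ with $M_0\le_{\mathfrak{k}}M_3$ such that both $M_1$ and $M_2$ can be $\le_{\mathfrak{k}}$-embedded into $M_3$ over $M_0$. For a regular cardinal $\kappa$, the $\kappa$-majority of $M\in K^{\mathfrak{k}}_\lambda$ satisfies a property $\psi$ if there is a function $F$ such that: (a) $\mathrm{Dom}(F)=\{M\in K_{\mathfrak{k}}: M$ has universe an ordinal in $[\lambda,\lambda^+)\}$;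 (b) if $M\in\mathrm{Dom}(F)$ then $M\le_{\mathfrak{k}}F(M)\in\mathrm{Dom}(F)$; (c) if $\langle M_\alpha:\alpha\le\kappa\rangle$ is $\le_{\mathfrak{k}}$-increasing continuous, each $M_\alpha\in\mathrm{Dom}(F)$, and $M_{2\alpha+2}=F(M_{2\alpha+1})$ for every $\alpha<\kappa$, then $M_\kappa$ satisfies $\psi$. -}

module Defs where

open import Level using (Level; 0ℓ; _⊔_) renaming (suc to lsuc)
open import Data.Bool.Base using (Bool)
open import Data.Fin.Base using (Fin)
open import Data.Nat.Base using (ℕ)
open import Data.Product.Base using (Σ; Σ-syntax; ∃; ∃-syntax; _×_; _,_)
open import Data.Refinement using (Refinement; refine; value; _,_)
open import Data.Sum.Base using (_⊎_)
open import Function.Base using (_∘_; id; _on_)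
open import Function.Bundles using (_↣_; _↔_; Injection)
open import Function.Definitions using (Injective; StrictlySurjective)
open import Induction.WellFounded using (WellFounded; Acc; acc)
open import Relation.Binary.Construct.Add.Supremum.Strict
  using (_<⁺_; [_]; [_]<⊤⁺; <⁺-isStrictTotalOrder-≡)
open import Relation.Binary.Core using (Rel)
open import Relation.Binary.Definitions using (Trichotomous; tri<; tri≈; tri>)
open import Relation.Binary.PropositionalEquality
  using (_≡_; _≗_; refl; cong; isEquivalence; resp₂)
open import Relation.Binary.Structures using (IsStrictTotalOrder)
import Relation.Binary.Construct.On as On
open import Relation.Nullary using (¬_)
open import Relation.Nullary.Construct.Add.Supremum using (_⁺; [_]; ⊤⁺)
open import Relation.Unary using (Pred; _⊆_; ∁; ∅; ｛_｝; ⋂; _∈_; _∉_)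

-- Sets are types in `Set`, cardinalities are compared by injections.

infix 4 _≺_

_≺_ : Set → Set → Set
A ≺ B = (A ↣ B) × ¬ (B ↣ A)

record Ordinal : Set₁ where
  infix 4 _<_
  field
    Carrier            : Set
    _<_                : Rel Carrier 0ℓ
    isStrictTotalOrder : IsStrictTotalOrder _≡_ _<_
    wellFounded        : WellFounded _<_

  open IsStrictTotalOrder isStrictTotalOrder public using (compare; irrefl; trans)

∣_∣ₒ : Ordinal → Set
∣_∣ₒ = Ordinal.Carrier

-- The ordinal a < o, as the initial segment of o below a.  The proof of
-- x < a is irrelevant, so that the segment has the right cardinality.

infixl 8 _↓_

_↓_ : (o : Ordinal) → ∣ o ∣ₒ → Ordinal
o ↓ a = record
  { Carrier            = Refinement ∣ o ∣ₒ (_< a)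
  ; _<_                = _<_ on value
  ; isStrictTotalOrder = record
    { isStrictPartialOrder = record
      { isEquivalence = isEquivalence
      ; irrefl        = λ { refl → irrefl refl }
      ; trans         = trans
      ; <-resp-≈      = resp₂ (_<_ on value)
      }
    ; compare = cmp
    }
  ; wellFounded = On.wellFounded value wellFounded
  }
  where
  open Ordinal o
  cmp : Trichotomous {A = Refinement ∣ o ∣ₒ (_< a)} _≡_ (_<_ on value)
  cmp (x , p) (y , q) with compare x y
  ... | tri< l ¬e ¬g    = tri< l (¬e ∘ cong value) ¬g
  ... | tri≈ ¬l refl ¬g = tri≈ ¬l refl ¬g
  ... | tri> ¬l ¬e g    = tri> ¬l (¬e ∘ cong value) g

-- The ordinal o + 1; its elements are the ordinals ≤ o, with o itself as ⊤⁺.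

_+1 : Ordinal → Ordinal
o +1 = record
  { Carrier            = ∣ o ∣ₒ ⁺
  ; _<_                = _<⁺_ _<_
  ; isStrictTotalOrder = <⁺-isStrictTotalOrder-≡ _<_ isStrictTotalOrder
  ; wellFounded        = wf
  }
  where
  open Ordinal o
  below : ∀ {x} → Acc _<_ x → Acc (_<⁺_ _<_) [ x ]
  below (acc rs) = acc λ { [ y<x ] → below (rs y<x) }
  wf : WellFounded (_<⁺_ _<_)
  wf [ x ] = below (wellFounded x)
  wf ⊤⁺    = acc λ { [ y ]<⊤⁺ → below (wellFounded y) }

-- Comparison of order types: an isomorphism onto an initial segment.

infix 4 _≼_

_≼_ : Ordinal → Ordinal → Set
o ≼ p = Σ[ f ∈ (∣ o ∣ₒ → ∣ p ∣ₒ) ]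
          (∀ {x y} → x <ₒ y → f x <ₚ f y)
        × (∀ {x z} → z <ₚ f x → ∃[ y ] f y ≡ z)
  where
  open Ordinal o using () renaming (_<_ to _<ₒ_)
  open Ordinal p using () renaming (_<_ to _<ₚ_)

IsLimit : Ordinal → Set
IsLimit o = ∣ o ∣ₒ × (∀ x → ∃[ y ] x < y)
  where open Ordinal o

module _ (o : Ordinal) where
  open Ordinal o

  IsSuc : ∣ o ∣ₒ → ∣ o ∣ₒ → Set
  IsSuc a b = a < b × (∀ c → ¬ (a < c × c < b))

  -- Twice a b says b = 2a, where 2a is the a-th even ordinal: writing
  -- a = δ + n with δ zero or limit and n finite, 2a = δ + 2n.

  data Twice : ∣ o ∣ₒ → ∣ o ∣ₒ → Set where
    zero-or-limit : ∀ {δ} → (∀ a → ¬ IsSuc a δ) → Twice δ δ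
    successor     : ∀ {a a′ b b′ b″} → Twice a b →
                    IsSuc a a′ → IsSuc b b′ → IsSuc b′ b″ → Twice a′ b″

-- Cardinals are initial ordinals.

IsCardinal : Ordinal → Set
IsCardinal o = ∀ a → ¬ (∣ o ∣ₒ ↣ ∣ o ↓ a ∣ₒ)

IsSuccessorCardinal : Ordinal → Ordinal → Set₁
IsSuccessorCardinal μ μ⁺ =
    IsCardinal μ⁺
  × ∣ μ ∣ₒ ≺ ∣ μ⁺ ∣ₒ
  × (∀ ν → IsCardinal ν → ∣ μ ∣ₒ ≺ ∣ ν ∣ₒ → μ⁺ ≼ ν)

IsStrongLimit : Ordinal → Set₁
IsStrongLimit μ =
    IsCardinal μ
  × (ℕ ↣ ∣ μ ∣ₒ)
  × (∀ {A : Set} → A ≺ ∣ μ ∣ₒ → (A → Bool) ≺ ∣ μ ∣ₒ)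

IsCofinalMap : (o p : Ordinal) → (∣ o ∣ₒ → ∣ p ∣ₒ) → Set
IsCofinalMap o p f = ∀ x → ∃[ i ] ¬ (f i < x)
  where open Ordinal p

-- IsCofinality κ μ says κ = cf(μ).

IsCofinality : Ordinal → Ordinal → Set₁
IsCofinality κ μ =
    ∃ (IsCofinalMap κ μ)
  × (∀ o → ∃ (IsCofinalMap o μ) → κ ≼ o)

record IsCompleteNonprincipalUltrafilter
         (κ : Ordinal) (U : Pred (Pred ∣ κ ∣ₒ 0ℓ) 0ℓ) : Set₁ where
  field
    proper       : ∅ ∉ U
    upward       : ∀ {A B} → A ⊆ B → A ∈ U → B ∈ U
    complete     : ∀ {I : Set} → I ≺ ∣ κ ∣ₒ → (A : I → Pred ∣ κ ∣ₒ 0ℓ) →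
                   (∀ i → A i ∈ U) → ⋂ I A ∈ U
    ultra        : ∀ A → A ∈ U ⊎ ∁ A ∈ U
    nonprincipal : ∀ x → ｛ x ｝ ∉ U

IsMeasurable : Ordinal → Set₁
IsMeasurable κ =
    IsCardinal κ
  × ℕ ≺ ∣ κ ∣ₒ
  × ∃ (IsCompleteNonprincipalUltrafilter κ)

record Vocabulary : Set₁ where
  field
    FunSym   : Set
    RelSym   : Set
    funArity : FunSym → ℕ
    relArity : RelSym → ℕ

module _ (τ : Vocabulary) where
  open Vocabulary τ

  -- Relations are Bool-valued so that, given function extensionality, ≡ on
  -- interpretations is equality of interpretations in the set-theoretic sense.

  record Interpretation (C : Set) : Set where
    field
      fun : (f : FunSym) → (Fin (funArity f) → C) → C
      rel : (r : RelSym) → (Fin (relArity r) → C) → Bool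

  record Structure : Set₁ where
    constructor ⟨_,_⟩
    field
      ∣_∣            : Set
      interpretation : Interpretation ∣_∣

    open Interpretation interpretation public

open Structure public using (∣_∣)

module _ {τ : Vocabulary} where
  open Vocabulary τ

  record IsEmbedding (M N : Structure τ) (f : ∣ M ∣ → ∣ N ∣) : Set where
    private
      module M = Structure M
      module N = Structure N
    field
      injective : Injective _≡_ _≡_ f
      pres-fun  : ∀ s xs → f (M.fun s xs) ≡ N.fun s (f ∘ xs)
      pres-rel  : ∀ r xs → M.rel r xs ≡ N.rel r (f ∘ xs)

  IsIsomorphism : (M N : Structure τ) → (∣ M ∣ → ∣ N ∣) → Set
  IsIsomorphism M N f = IsEmbedding M N f × StrictlySurjective _≡_ f

  -- N is the union of the increasing continuous chain (M i : i < δ), where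
  -- inj i and map p play the role of the inclusions of M i in N and in M j.

  record IsUnionOfChain
           (δ : Ordinal)
           (M : ∣ δ ∣ₒ → Structure τ)
           (map : ∀ {i j} → Ordinal._<_ δ i j → ∣ M i ∣ → ∣ M j ∣)
           (N : Structure τ)
           (inj : ∀ i → ∣ M i ∣ → ∣ N ∣) : Set where
    open Ordinal δ using (_<_)
    field
      embedding  : ∀ i → IsEmbedding (M i) N (inj i)
      commute    : ∀ {i j} (p : i < j) → inj j ∘ map p ≗ inj i
      cover      : ∀ x → ∃[ i ] ∃[ y ] inj i y ≡ x
      continuous : ∀ j → IsLimit (δ ↓ j) → (x : ∣ M j ∣) →
                   ∃[ i ] Σ (i < j) λ p → ∃[ y ] map p y ≡ x

-- Types have no global inclusion relation, so ≤ is a relation along maps.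
-- `M ≤ N via f` reads: f is an isomorphism of M onto some M′ with M′ ≤ N
-- (a ≤-embedding); when f is an inclusion, this is M ≤ N.

record AEC (τ : Vocabulary) (ℓ : Level) : Set (lsuc (0ℓ ⊔ ℓ)) where
  field
    K        : Structure τ → Set ℓ
    _≤_via_  : (M N : Structure τ) → (∣ M ∣ → ∣ N ∣) → Set ℓ

    ≤⇒Kˡ : ∀ {M N f} → M ≤ N via f → K M
    ≤⇒Kʳ : ∀ {M N f} → M ≤ N via f → K N
    ≤⇒⊆  : ∀ {M N f} → M ≤ N via f → IsEmbedding M N f

    K-resp-≅ : ∀ {M N i} → IsIsomorphism M N i → K M → K N
    ≤-resp-≅ : ∀ {M N M′ N′ f f′ i j} →
               IsIsomorphism M M′ i → IsIsomorphism N N′ j →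
               f′ ∘ i ≗ j ∘ f → M ≤ N via f → M′ ≤ N′ via f′

    ≤-refl  : ∀ {M} → K M → M ≤ M via id
    ≤-trans : ∀ {M N P f g} → M ≤ N via f → N ≤ P via g → M ≤ P via (g ∘ f)

    empty-≤ : ∀ {M N f} → K M → K N → ¬ ∣ M ∣ →
              IsEmbedding M N f → M ≤ N via f

    chain-union :
      ∀ δ (M : ∣ δ ∣ₒ → Structure τ)
      (map : ∀ {i j} → Ordinal._<_ δ i j → ∣ M i ∣ → ∣ M j ∣)
      {N} (inj : ∀ i → ∣ M i ∣ → ∣ N ∣) →
      IsLimit δ →
      (∀ {i j} (p : Ordinal._<_ δ i j) → M i ≤ M j via map p) →
      IsUnionOfChain δ M map N inj →
      ∀ i → M i ≤ N via inj i
    chain-smooth :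
      ∀ δ (M : ∣ δ ∣ₒ → Structure τ)
      (map : ∀ {i j} → Ordinal._<_ δ i j → ∣ M i ∣ → ∣ M j ∣)
      {N} (inj : ∀ i → ∣ M i ∣ → ∣ N ∣) {P f} →
      IsLimit δ →
      (∀ {i j} (p : Ordinal._<_ δ i j) → M i ≤ M j via map p) →
      IsUnionOfChain δ M map N inj →
      IsEmbedding N P f → (∀ i → M i ≤ P via (f ∘ inj i)) →
      N ≤ P via f

    coherence : ∀ {M N P f g} → IsEmbedding M N f →
                N ≤ P via g → M ≤ P via (g ∘ f) → M ≤ N via f

  -- χ ≥ |τ| + ℵ₀, and every A ⊆ N ∈ K is contained in some M ≤ N with
  -- ‖M‖ ≤ |A| + χ.

  IsLSTBound : Set → Set (lsuc 0ℓ ⊔ ℓ)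
  IsLSTBound χ =
      ((Vocabulary.FunSym τ ⊎ Vocabulary.RelSym τ ⊎ ℕ) ↣ χ)
    × (∀ {N} → K N → {A : Set} (a : A ↣ ∣ N ∣) →
       Σ (Structure τ) λ M → Σ (∣ M ∣ → ∣ N ∣) λ f →
         M ≤ N via f
       × (∀ x → ∃[ y ] f y ≡ Injection.to a x)
       × (∣ M ∣ ↣ (A ⊎ χ)))

  -- The cardinal LST is given by a type of that cardinality.

  field
    LST       : Set
    LST-bound : IsLSTBound LST
    LST-least : ∀ χ → IsLSTBound χ → LST ↣ χ

module _ {τ : Vocabulary} {ℓ : Level} (𝔨 : AEC τ ℓ) where
  open AEC 𝔨

  K[_] : Ordinal → Structure τ → Set ℓ
  K[ μ ] M = K M × (∣ M ∣ ↔ ∣ μ ∣ₒ)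

  IsAmalgamationBase : Ordinal → Structure τ → Set (lsuc 0ℓ ⊔ ℓ)
  IsAmalgamationBase μ M₀ =
      K[ μ ] M₀
    × (∀ M₁ M₂ f₁ f₂ → K[ μ ] M₁ → K[ μ ] M₂ →
       M₀ ≤ M₁ via f₁ → M₀ ≤ M₂ via f₂ →
       Σ (Structure τ) λ M₃ → Σ (∣ M₀ ∣ → ∣ M₃ ∣) λ h →
       Σ (∣ M₁ ∣ → ∣ M₃ ∣) λ g₁ → Σ (∣ M₂ ∣ → ∣ M₃ ∣) λ g₂ →
         M₀ ≤ M₃ via h
       × M₁ ≤ M₃ via g₁ × g₁ ∘ f₁ ≗ h
       × M₂ ≤ M₃ via g₂ × g₂ ∘ f₂ ≗ h)

  -- The ordinals below μ⁺ are the elements of (the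
  -- well-order) μ⁺, so structures with universe an ordinal α < μ⁺ have
  -- literal inclusions between their universes.

  module _ (μ⁺ : Ordinal) where
    open Ordinal μ⁺ using (_<_)

    record OrdStructure : Set where
      field
        universe       : ∣ μ⁺ ∣ₒ
        interpretation : Interpretation τ ∣ μ⁺ ↓ universe ∣ₒ

      structure : Structure τ
      structure = ⟨ ∣ μ⁺ ↓ universe ∣ₒ , interpretation ⟩

    open OrdStructure

    InDom : Ordinal → OrdStructure → Set ℓ
    InDom μ M = K (structure M) × μ ≼ (μ⁺ ↓ universe M)

    _≤ₒ_ : OrdStructure → OrdStructure → Set ℓ
    M ≤ₒ N = Σ (∀ {x} → x < universe M → x < universe N) λ p →
             structure M ≤ structure N via refine (λ {x} → p {x})

    module _ (κ : Ordinal) where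
      open Ordinal (κ +1) using () renaming (_<_ to _<κ_)

      record IsChain (M : ∣ κ +1 ∣ₒ → OrdStructure) : Set ℓ where
        field
          increasing : ∀ {i j} → i <κ j → M i ≤ₒ M j
          continuous : ∀ j → IsLimit ((κ +1) ↓ j) → ∀ {x} →
                       x < universe (M j) →
                       ∃[ i ] i <κ j × x < universe (M i)

      -- M_{2α+2} = F(M_{2α+1}) for all α < κ

      Obeys : (OrdStructure → OrdStructure) →
              (∣ κ +1 ∣ₒ → OrdStructure) → Set
      Obeys F M = ∀ (α : ∣ κ ∣ₒ) {β β′ β″} → Twice (κ +1) [ α ] β →
                  IsSuc (κ +1) β β′ → IsSuc (κ +1) β′ β″ →
                  M β″ ≡ F (M β′)

  -- F is only constrained on InDom; its values elsewhere play no role.  The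
  -- successor cardinal μ⁺ is unique up to isomorphism.

  Majority : ∀ {p} → Ordinal → Ordinal → Pred (Structure τ) p →
             Set (lsuc 0ℓ ⊔ ℓ ⊔ p)
  Majority κ μ ψ =
    ∀ μ⁺ → IsSuccessorCardinal μ μ⁺ →
    Σ (OrdStructure μ⁺ → OrdStructure μ⁺) λ F →
      (∀ M → InDom μ⁺ μ M → _≤ₒ_ μ⁺ M (F M) × InDom μ⁺ μ (F M))
    × (∀ M → (∀ i → InDom μ⁺ μ (M i)) → IsChain μ⁺ κ M → Obeys μ⁺ κ F M →
       ψ (OrdStructure.structure (M ⊤⁺)))

  HasAmalgamationBases : Ordinal → Ordinal → Set (lsuc 0ℓ ⊔ ℓ)
  HasAmalgamationBases μ κ = Majority κ μ (IsAmalgamationBase μ)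

{-# OPTIONS --safe #-}

-- Fix a κ-complete nonprincipal ultrafilter U on κ = cf(μ) and a map y : κ → μ
-- with { i : x < y i } ∈ U for every x < μ.  Given M of size μ, let h be a
-- bijection of M with μ.  As μ is a strong limit, there are at most μ pairs
-- (i, B), up to isomorphism, of a small model B and a partial map of B onto part
-- of h⁻¹(y i); F(M) is the union of a chain of length μ along which every such
-- pair that embeds over M in some later extension has been embedded.  If
-- M_κ ≤ N has size μ, write N as the union of small B_i ≤ N covering the first
-- y i points of N.  For all α and i there is then g_{α,i} : B_i → M_{2α+2} that is
-- the identity on the first y i points of M_{2α+1}, and x ↦ [ g_{α,i}(x) ] embeds N
-- in the ultrapower of M_κ by U ⊗ U over the diagonal.  The second index α makes
-- it unnecessary to relate the enumerations of the various M_{2α+1}.  Two such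
-- N embed in the same ultrapower, so they are amalgamated over M_κ.
--
-- The only part of the ultrapower needed is the union of a directed system of
-- models of size < κ, each of which is, after identifying almost all coordinates,
-- a family of submodels of M_κ.

module Submission where

open import Defs
open import Level using (Level; 0ℓ; _⊔_) renaming (suc to lsuc)
open import Axiom.ExcludedMiddle using (ExcludedMiddle)
open import Axiom.Extensionality.Propositional using (Extensionality)
open import Data.Bool.Base using (Bool; true; false; not; if_then_else_)
open import Data.Empty using (⊥; ⊥-elim)
open import Data.Fin.Base using (Fin; zero; suc)
open import Data.Irrelevant using ([_])
open import Data.List.Base using (List; []; _∷_; _++_; foldr; cartesianProductWith; tabulate)
open import Data.List.Membership.Propositional using (_∈_)
open import Data.List.Membership.Propositional.Properties
  using (∈-++⁺ˡ; ∈-++⁺ʳ; ∈-++⁻; ∈-cartesianProductWith⁺; ∈-cartesianProductWith⁻)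
open import Data.List.Properties using (∷-injectiveˡ; ∷-injectiveʳ)
open import Data.List.Relation.Unary.Any using (here; there)
open import Data.Nat.Base as ℕ using (ℕ; zero; suc)
import Data.Nat.Induction as ℕ
import Data.Nat.Properties as ℕ
open import Data.Product.Base using (Σ; ∃; ∃-syntax; _×_; _,_; proj₁; proj₂)
open import Data.Product.Relation.Binary.Lex.Strict using (×-Lex; ×-wellFounded; ×-compare)
open import Data.Refinement using (Refinement; refine; value; value-injective; _,_)
open import Data.Sum.Base as Sum using (_⊎_; inj₁; inj₂)
open import Data.Sum.Properties using (inj₁-injective; inj₂-injective)
open import Data.Unit.Base using (⊤; tt)
open import Function.Base using (_∘_; id; _on_)
open import Function.Bundles using (_↣_; _↔_; Injection; Inverse; mk↣; mk↔ₛ′)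
open import Function.Definitions using (Injective)
open import Induction.WellFounded using (WellFounded; Acc; acc; module All; module FixPoint)
open import Relation.Binary.Construct.Add.Supremum.Strict using ([_]; [_]<⊤⁺)
import Relation.Binary.Construct.On as On
open import Relation.Binary.Core using (Rel)
open import Relation.Binary.Definitions using (tri<; tri≈; tri>)
open import Relation.Binary.PropositionalEquality hiding (J; [_])
open import Relation.Nullary using (¬_; Dec; yes; no; does; contradiction; recompute)
open import Relation.Nullary.Construct.Add.Supremum using ([_]; ⊤⁺)
open import Relation.Nullary.Decidable using (dec-true)
open import Relation.Unary using (Pred)

-- No Łoś theorem is available for an abstract elementary class. Its place is taken by a counting
-- argument: a map from the index set to the diagrams of submodels of size below κ is constant
-- almost everywhere, so one isomorphism type can be followed through almost all coordinates.
--
-- Two notions of smallness are in play. The models B_i that F deals with have size at most |y i| +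
-- LST, which is below μ but may exceed κ; for them the strong limit bounds the number of diagrams.
-- Submodels of the ultrapower have size below κ, and for them measurability is used. The two meet
-- because a submodel of N of size below κ lies inside B_i for almost every i. The maps g_{α,i} have
-- no reason to commute with each other, yet on such a submodel almost all of them are defined, and
-- together they induce its embedding.
--
-- The second obstacle is that the union axioms speak of well-ordered chains, while small submodels
-- form directed systems. The passage is `closure-good`, an induction on the length of a list of
-- generators.

module Proof (em : ∀ {a} → ExcludedMiddle a) (ext : ∀ {a b} → Extensionality a b) where

  private variable
    a b ℓ′ : Level
    A B C E J Q R X : Set

  -- Classical choice

  bool : Set a → Bool
  bool P = does (em {P = P})

  bool-true : {P : Set a} → P → bool P ≡ true
  bool-true = dec-true em

  bool-sound : {P : Set a} → bool P ≡ true → P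
  bool-sound {P = P} eq with em {P = P}
  ... | yes p = p
  ... | no _ with () ← eq

  bool-cong : {P : Set a} {Q : Set b} → (P → Q) → (Q → P) → bool P ≡ bool Q
  bool-cong {P = P} {Q} f g with em {P = P} | em {P = Q}
  ... | yes _ | yes _ = refl
  ... | no _  | no _  = refl
  ... | yes p | no ¬q = contradiction (f p) ¬q
  ... | no ¬p | yes q = contradiction (g q) ¬p

  byContradiction : {P : Set a} → ¬ ¬ P → P
  byContradiction {P = P} ¬¬p with em {P = P}
  ... | yes p = p
  ... | no ¬p = contradiction ¬p ¬¬p

  ¬∀⇒∃¬ : {X : Set a} {P : X → Set b} → ¬ (∀ x → P x) → ∃[ x ] ¬ P x
  ¬∀⇒∃¬ ¬∀ = byContradiction λ ¬∃ → ¬∀ λ x → byContradiction λ ¬p → ¬∃ (x , ¬p)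

  -- The proof stored in a `Refinement` is irrelevant; excluded middle decides the property, so
  -- `recompute` can restore a usable proof.
  member : {X : Set a} {P : X → Set b} (x : Refinement X P) → P (value x)
  member (_ , [ p ]) = recompute em p

  infixr 4 _,′_
  _,′_ : {X : Set a} {P : X → Set b} (x : X) → P x → Refinement X P
  x ,′ p = x , [ p ]

  ↣-injective : (f : A ↣ B) {x y : A} → Injection.to f x ≡ Injection.to f y → x ≡ y
  ↣-injective f = Injection.injective f

  infixr 9 _∘↣_
  _∘↣_ : B ↣ C → A ↣ B → A ↣ C
  g ∘↣ f = mk↣ (λ eq → ↣-injective f (↣-injective g eq))

  value↣ : {P : A → Set b} → Refinement A P ↣ A
  value↣ = mk↣ value-injective

  section↣ : (h : A → B) (s : B → A) → (∀ y → h (s y) ≡ y) → B ↣ A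
  section↣ h s hs = mk↣ {to = s} λ {x} {y} eq → trans (sym (hs x)) (trans (cong h eq) (hs y))

  infixr 1 _⊎↣_
  _⊎↣_ : {A′ B′ : Set} → A ↣ A′ → B ↣ B′ → (A ⊎ B) ↣ (A′ ⊎ B′)
  _⊎↣_ {A} {B} f g = mk↣ {to = to} to-injective
    where
    to = Sum.map (Injection.to f) (Injection.to g)
    to-injective : ∀ {x y : A ⊎ B} → to x ≡ to y → x ≡ y
    to-injective {inj₁ _} {inj₁ _} eq = cong inj₁ (↣-injective f (inj₁-injective eq))
    to-injective {inj₂ _} {inj₂ _} eq = cong inj₂ (↣-injective g (inj₂-injective eq))

  list↣ : List A ↣ (ℕ → ⊤ ⊎ A)
  list↣ {A} = mk↣ {to = nth} nth-injective
    where
    nth : List A → ℕ → ⊤ ⊎ A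
    nth []      _       = inj₁ tt
    nth (x ∷ l) zero    = inj₂ x
    nth (x ∷ l) (suc n) = nth l n
    nth-injective : ∀ {l l′} → nth l ≡ nth l′ → l ≡ l′
    nth-injective {[]}    {[]}     eq = refl
    nth-injective {[]}    {_ ∷ _}  eq with () ← cong (λ h → h 0) eq
    nth-injective {_ ∷ _} {[]}     eq with () ← cong (λ h → h 0) eq
    nth-injective {_ ∷ _} {_ ∷ _}  eq =
      cong₂ _∷_ (inj₂-injective (cong (λ h → h 0) eq)) (nth-injective (cong (_∘ suc) eq))

  surjection⇒↣ : (h : A → B) → (∀ y → ∃[ x ] h x ≡ y) → B ↣ A
  surjection⇒↣ h s = section↣ h (proj₁ ∘ s) (proj₂ ∘ s)

  ↔⇒↣ : A ↔ B → A ↣ B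
  ↔⇒↣ f = section↣ (Inverse.from f) (Inverse.to f) (Inverse.strictlyInverseʳ f)

  bijection : (f : A → B) → (∀ {x y} → f x ≡ f y → x ≡ y) → (∀ y → ∃[ x ] f x ≡ y) → A ↔ B
  bijection f inj surj =
    mk↔ₛ′ f (proj₁ ∘ surj) (proj₂ ∘ surj) λ x → inj (proj₂ (surj (f x)))

  -- The Cantor-Schröder-Bernstein theorem.

  module _ (f : A ↣ B) (g : B ↣ A) where
    private
      f₀ = Injection.to f
      g₀ = Injection.to g

      data Orbit : A → Set where
        base : ∀ {x} → (∀ y → g₀ y ≢ x) → Orbit x
        step : ∀ {x} → Orbit x → Orbit (g₀ (f₀ x))

      ¬orbit-preimage : ∀ {x} → ¬ Orbit x → ∃[ y ] g₀ y ≡ x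
      ¬orbit-preimage ¬o = byContradiction λ ¬∃ → ¬o (base λ y eq → ¬∃ (y , eq))

      -- f on the points whose backward orbit stops in A, and g⁻¹ elsewhere
      to-with : ∀ x → Dec (Orbit x) → B
      to-with x (yes _) = f₀ x
      to-with x (no ¬o) = proj₁ (¬orbit-preimage ¬o)

      to : A → B
      to x = to-with x em

      to-orbit : ∀ {x} → Orbit x → ∀ d → to-with x d ≡ f₀ x
      to-orbit o (yes _) = refl
      to-orbit o (no ¬o) = contradiction o ¬o

      to-¬orbit : ∀ {x} → ¬ Orbit x → ∀ d → g₀ (to-with x d) ≡ x
      to-¬orbit ¬o (yes o) = contradiction o ¬o
      to-¬orbit _  (no ¬o) = proj₂ (¬orbit-preimage ¬o)

      orbits-apart : ∀ {x y} (¬o : ¬ Orbit y) → Orbit x → f₀ x ≢ proj₁ (¬orbit-preimage ¬o)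
      orbits-apart ¬o o eq =
        ¬o (subst Orbit (trans (cong g₀ eq) (proj₂ (¬orbit-preimage ¬o))) (step o))

      to-injective : ∀ {x y} d d′ → to-with x d ≡ to-with y d′ → x ≡ y
      to-injective (yes _) (yes _) eq = ↣-injective f eq
      to-injective (yes o) (no ¬p) eq = contradiction eq (orbits-apart ¬p o)
      to-injective (no ¬o) (yes p) eq = contradiction (sym eq) (orbits-apart ¬o p)
      to-injective (no ¬o) (no ¬p) eq = trans (sym (proj₂ (¬orbit-preimage ¬o)))
        (trans (cong g₀ eq) (proj₂ (¬orbit-preimage ¬p)))

      preimage : ∀ {x} → Orbit x → ∀ {y} → g₀ y ≡ x → ∃[ x ] to x ≡ y
      preimage (base ¬y) eq     = contradiction eq (¬y _)
      preimage (step {x} o) eq = x , trans (to-orbit o em) (sym (↣-injective g eq))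

      to-surjective : ∀ y → ∃[ x ] to x ≡ y
      to-surjective y with em {P = Orbit (g₀ y)}
      ... | yes o = preimage o refl
      ... | no ¬o = g₀ y , ↣-injective g (to-¬orbit ¬o em)

    cantor-schröder-bernstein : A ↔ B
    cantor-schröder-bernstein = bijection to (to-injective em em) to-surjective

  -- Well-orders and recursion along them.

  least : {X : Set} {_<_ : Rel X 0ℓ} → WellFounded _<_ → (P : X → Set ℓ′) → ∃ P →
          ∃[ x ] P x × (∀ {y} → y < x → ¬ P y)
  least {_<_ = _<_} wf P (x , p) = go (wf x) p
    where
    go : ∀ {x} → Acc _<_ x → P x → ∃[ x ] P x × (∀ {y} → y < x → ¬ P y)
    go {x} (acc rs) p with em {P = ∃[ y ] y < x × P y}
    ... | yes (y , y<x , q) = go (rs y<x) q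
    ... | no ¬∃             = x , p , λ y<x q → ¬∃ (_ , y<x , q)

  module OrdinalProperties (o : Ordinal) where
    open Ordinal o hiding (trans) public
    open Ordinal o using () renaming (trans to <-trans) public

    infix 4 _≤_
    _≤_ : Rel ∣ o ∣ₒ 0ℓ
    x ≤ y = ¬ (y < x)

    <-irrefl : ∀ {x} → ¬ (x < x)
    <-irrefl = irrefl refl

    <⇒≤ : ∀ {x y} → x < y → x ≤ y
    <⇒≤ p q = <-irrefl (<-trans p q)

    ≤-≢⇒< : ∀ {x y} → x ≤ y → x ≢ y → x < y
    ≤-≢⇒< {x} {y} x≤y x≢y with compare x y
    ... | tri< l _ _ = l
    ... | tri≈ _ e _ = contradiction e x≢y
    ... | tri> _ _ g = contradiction g x≤y

    ≤-<-trans : ∀ {x y z} → x ≤ y → y < z → x < z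
    ≤-<-trans {x} {y} x≤y y<z with compare x y
    ... | tri< l _ _ = <-trans l y<z
    ... | tri≈ _ refl _ = y<z
    ... | tri> _ _ g = contradiction g x≤y

    <-≤-trans : ∀ {x y z} → x < y → y ≤ z → x < z
    <-≤-trans {x} {y} {z} x<y y≤z with compare y z
    ... | tri< l _ _ = <-trans x<y l
    ... | tri≈ _ refl _ = x<y
    ... | tri> _ _ g = contradiction g y≤z

    ≤-trans : ∀ {x y z} → x ≤ y → y ≤ z → x ≤ z
    ≤-trans x≤y y≤z z<x = y≤z (<-≤-trans z<x x≤y)

    _⊓⊔_ : ∀ x y → x ≤ y ⊎ y < x
    x ⊓⊔ y with compare x y
    ... | tri< l _ _ = inj₁ (<⇒≤ l)
    ... | tri≈ _ refl _ = inj₁ <-irrefl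
    ... | tri> _ _ g = inj₂ g

    segment↣ : ∀ {x y} → x ≤ y → ∣ o ↓ x ∣ₒ ↣ ∣ o ↓ y ∣ₒ
    segment↣ x≤y = mk↣ {to = refine (λ z<x → <-≤-trans z<x x≤y)} λ eq → value-injective (cong value eq)

    succ : (x : ∣ o ∣ₒ) → (∃[ y ] x < y) → ∃[ y ] IsSuc o x y
    succ x above with least wellFounded (x <_) above
    ... | y , x<y , min = y , x<y , λ c (x<c , c<y) → min c<y x<c

  -- The sequence is defined unconditionally, with `x₀` wherever no good value exists. That good
  -- values exist is supplied afterwards, by an induction that may use the goodness of all earlier
  -- values. `local` makes the padding outside the initial segment harmless.
  module ChoiceRecursion
    {W X : Set} {_<W_ : Rel W 0ℓ} (wf : WellFounded _<W_) (x₀ : X)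
    {p : Level} (Good : W → (W → X) → X → Set p)
    (local : ∀ {w h h′ x} → (∀ {v} → v <W w → h v ≡ h′ v) → Good w h x → Good w h′ x) where

    private
      total : ∀ {w} → (∀ {v} → v <W w → X) → ∀ v → Dec (v <W w) → X
      total h v (yes p) = h p
      total h v (no _)  = x₀

      choose : ∀ w h → Dec (∃ (Good w h)) → X
      choose w h (yes (x , _)) = x
      choose w h (no _)        = x₀

      step : ∀ w → (∀ {v} → v <W w → X) → X
      step w h = choose w (λ v → total {w} h v em) em

      step-ext : ∀ w {h h′ : ∀ {v} → v <W w → X} →
                 (∀ {v} (p : v <W w) → h p ≡ h′ p) → step w h ≡ step w h′
      step-ext w {h} {h′} eq = cong (λ k → step w (λ {v} → k v))
        {x = λ v → h {v}} {y = λ v → h′ {v}} (ext λ v → ext λ p → eq p)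

      choose-good : ∀ w h d → ∃ (Good w h) → Good w h (choose w h d)
      choose-good w h (yes (x , good)) _ = good
      choose-good w h (no ¬∃)          g = contradiction g ¬∃

    abstract
      sequence : W → X
      sequence = All.wfRec wf 0ℓ _ step

      private
        total-sequence : ∀ {w v} → v <W w → (d : Dec (v <W w)) →
                         total {w} (λ {v} _ → sequence v) v d ≡ sequence v
        total-sequence p (yes _) = refl
        total-sequence p (no ¬p) = contradiction p ¬p

      sequence-good : ∀ w → ∃ (Good w sequence) → Good w sequence (sequence w)
      sequence-good w (x , good) = subst (Good w sequence)
        (sym (FixPoint.unfold-wfRec wf _ step step-ext {w}))
        (local (λ p → total-sequence p em)
          (choose-good w _ em (x , local (λ p → sym (total-sequence p em)) good)))

  -- Well-founded recursion by least excluded values: mex w is the least element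
  -- that is neither avoided nor of the form mex v with v < w.
  module Mex (Ω : Ordinal) (ω₀ : ∣ Ω ∣ₒ) {W : Set} {_<W_ : Rel W 0ℓ} (wf : WellFounded _<W_)
             (Avoid : ∣ Ω ∣ₒ → Set)
             (room : ∀ w (h : W → ∣ Ω ∣ₒ) → ∃[ x ] ¬ Avoid x × (∀ {v} → v <W w → h v ≢ x)) where
    open OrdinalProperties Ω

    private
      Free : W → (W → ∣ Ω ∣ₒ) → ∣ Ω ∣ₒ → Set
      Free w h x = ¬ Avoid x × (∀ {v} → v <W w → h v ≢ x)

      LeastFree : W → (W → ∣ Ω ∣ₒ) → ∣ Ω ∣ₒ → Set
      LeastFree w h x = Free w h x × (∀ {y} → y < x → ¬ Free w h y)

      free-local : ∀ {w h h′ x} → (∀ {v} → v <W w → h v ≡ h′ v) → Free w h x → Free w h′ x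
      free-local eq (¬a , fresh) = ¬a , λ p e → fresh p (trans (eq p) e)

      least-local : ∀ {w h h′ x} → (∀ {v} → v <W w → h v ≡ h′ v) → LeastFree w h x → LeastFree w h′ x
      least-local eq (free , minimal) =
        free-local eq free , λ y<x free → minimal y<x (free-local (sym ∘ eq) free)

    open ChoiceRecursion wf ω₀ LeastFree least-local public using () renaming (sequence to mex)
    open ChoiceRecursion wf ω₀ LeastFree least-local using (sequence-good)

    private
      spec : ∀ w → LeastFree w mex (mex w)
      spec w = sequence-good w (least wellFounded (Free w mex) (room w mex))

    mex-avoids : ∀ w → ¬ Avoid (mex w)
    mex-avoids w = proj₁ (proj₁ (spec w))

    mex-fresh : ∀ {v w} → v <W w → mex v ≢ mex w
    mex-fresh p = proj₂ (proj₁ (spec _)) p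

    -- The values leave no gaps above the avoided points. This is what makes the extended universe
    -- in `Realise` an ordinal.
    mex-least : ∀ w {x} → x < mex w → ¬ Avoid x → ∃[ v ] mex v ≡ x
    mex-least w {x} x<w ¬a = byContradiction λ ¬∃ →
      proj₂ (spec w) x<w (¬a , λ {v} _ eq → ¬∃ (v , eq))

    mex-injective : (∀ v w → v ≢ w → v <W w ⊎ w <W v) → ∀ {v w} → mex v ≡ mex w → v ≡ w
    mex-injective connex {v} {w} eq = byContradiction λ v≢w → case (connex v w v≢w)
      where
      case : v <W w ⊎ w <W v → ⊥
      case (inj₁ p) = mex-fresh p eq
      case (inj₂ p) = mex-fresh p (sym eq)

  connex : (o : Ordinal) → ∀ x y → x ≢ y → Ordinal._<_ o x y ⊎ Ordinal._<_ o y x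
  connex o x y x≢y with Ordinal.compare o x y
  ... | tri< l _ _ = inj₁ l
  ... | tri≈ _ e _ = contradiction e x≢y
  ... | tri> _ _ g = inj₂ g

  ≼⇒↣ : ∀ o p → o ≼ p → ∣ o ∣ₒ ↣ ∣ p ∣ₒ
  ≼⇒↣ o p (f , increasing , _) = mk↣ {to = f} λ {x} {y} eq → byContradiction λ x≢y →
    Sum.[ (λ l → <-irrefl {f y} (subst (_< f y) eq (increasing l)))
        , (λ l → <-irrefl {f y} (subst (f y <_) eq (increasing l))) ] (connex o x y x≢y)
    where open OrdinalProperties p

  -- Cardinal arithmetic below a strong limit

  Bool-ext : ∀ {b c} → (b ≡ true → c ≡ true) → (c ≡ true → b ≡ true) → b ≡ c
  Bool-ext {true}  {c}     f g = sym (f refl)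
  Bool-ext {false} {true}  f g = g refl
  Bool-ext {false} {false} f g = refl

  singleton↣ : A ↣ (A → Bool)
  singleton↣ = mk↣ {to = λ x y → bool (x ≡ y)} λ {x} {x′} eq →
    bool-sound (trans (cong (λ S → S x′) eq) (bool-true refl))

  power↣ : A ↣ B → (A → Bool) ↣ (B → Bool)
  power↣ {A} {B} f = mk↣ {to = image} λ {S} {S′} eq → ext λ a →
    Bool-ext (transfer S S′ eq a) (transfer S′ S (sym eq) a)
    where
    Image : (A → Bool) → B → Set
    Image S b = ∃[ a ] Injection.to f a ≡ b × S a ≡ true
    image : (A → Bool) → B → Bool
    image S b = bool (Image S b)
    transfer : ∀ S S′ → image S ≡ image S′ → ∀ a → S a ≡ true → S′ a ≡ true
    transfer S S′ eq a Sa with bool-sound {P = Image S′ (Injection.to f a)}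
      (trans (cong (λ S → S (Injection.to f a)) (sym eq)) (bool-true (a , refl , Sa)))
    ... | a′ , fa′≡fa , S′a′ = subst (λ x → S′ x ≡ true) (↣-injective f fa′≡fa) S′a′

  ×↣power : (A × B) ↣ (A ⊎ B → Bool)
  ×↣power = mk↣ {to = λ (a , b) → Sum.[ (λ x → bool (a ≡ x)) , (λ y → bool (b ≡ y)) ]} λ {p} {q} eq →
    cong₂ _,_ (↣-injective singleton↣ (cong (_∘ inj₁) eq)) (↣-injective singleton↣ (cong (_∘ inj₂) eq))

  -- One copy of `a` becomes the principal ultrafilter at `a`, the other its complement; the full
  -- subset tells the two kinds apart.
  ⊎↣power² : (A ⊎ A) ↣ ((A → Bool) → Bool)
  ⊎↣power² {A} = mk↣ {to = to} to-injective
    where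
    to : A ⊎ A → (A → Bool) → Bool
    to (inj₁ a) S = S a
    to (inj₂ a) S = not (S a)
    not-injective : ∀ {b c} → not b ≡ not c → b ≡ c
    not-injective {true}  {true}  _ = refl
    not-injective {false} {false} _ = refl
    to-injective : ∀ {x y} → to x ≡ to y → x ≡ y
    to-injective {inj₁ a} {inj₁ b} eq = cong inj₁ (sym (bool-sound
      (trans (cong (λ h → h (λ x → bool (b ≡ x))) eq) (bool-true refl))))
    to-injective {inj₁ a} {inj₂ b} eq with () ← cong (λ h → h (λ _ → true)) eq
    to-injective {inj₂ a} {inj₁ b} eq with () ← cong (λ h → h (λ _ → true)) eq
    to-injective {inj₂ a} {inj₂ b} eq = cong inj₂ (sym (bool-sound
      (trans (not-injective (cong (λ h → h (λ x → bool (b ≡ x))) eq)) (bool-true refl))))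

  graph↣ : (A → B) ↣ (A × B → Bool)
  graph↣ = mk↣ {to = λ f (x , y) → bool (f x ≡ y)} λ {f} {g} eq → ext λ x →
    bool-sound (trans (cong (λ S → S (x , g x)) eq) (bool-true refl))

  -- A strong limit above |X| is above every finite iterate of the power set of `X`. These iterates
  -- absorb sums, products and function spaces, so crude bounds suffice.
  Tower : Set → ℕ → Set
  Tower X zero    = X
  Tower X (suc k) = Tower X k → Bool

  -- The cardinality of A is less than ℶ_ω(|X|).
  InTower : Set → Set → Set
  InTower X A = ∃[ k ] (A ↣ Tower X k)

  tower-lift : ∀ j {k} → Tower X k ↣ Tower X (j ℕ.+ k)
  tower-lift zero    = mk↣ id
  tower-lift (suc j) = singleton↣ ∘↣ tower-lift j

  tower-common : InTower X A → InTower X B → ∃[ k ] (A ↣ Tower X k) × (B ↣ Tower X k)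
  tower-common {X} {B = B} (k , f) (l , g) = l ℕ.+ k , tower-lift l ∘↣ f ,
    subst (λ n → B ↣ Tower X n) (ℕ.+-comm k l) (tower-lift k ∘↣ g)

  tower-↣ : A ↣ B → InTower X B → InTower X A
  tower-↣ f (k , g) = k , g ∘↣ f

  tower-power : InTower X A → InTower X (A → Bool)
  tower-power (k , f) = suc k , power↣ f

  tower-⊎ : InTower X A → InTower X B → InTower X (A ⊎ B)
  tower-⊎ a b with tower-common a b
  ... | k , f , g = 2 ℕ.+ k , ⊎↣power² ∘↣ (f ⊎↣ g)

  tower-× : InTower X A → InTower X B → InTower X (A × B)
  tower-× a b = tower-↣ ×↣power (tower-power (tower-⊎ a b))

  tower-→ : InTower X A → InTower X B → InTower X (A → B)
  tower-→ a b = tower-↣ graph↣ (tower-power (tower-× a b))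

  tower-⊤ : InTower X ⊤
  tower-⊤ = 1 , mk↣ {to = λ _ _ → true} (λ _ → refl)

  tower-List : InTower X ℕ → InTower X A → InTower X (List A)
  tower-List n a = tower-↣ list↣ (tower-→ n (tower-⊎ tower-⊤ a))

  module StrongLimit (μ : Ordinal) (strongLimit : IsStrongLimit μ) where
    open OrdinalProperties μ

    isCardinal : IsCardinal μ
    isCardinal = proj₁ strongLimit

    ℕ↣μ : ℕ ↣ ∣ μ ∣ₒ
    ℕ↣μ = proj₁ (proj₂ strongLimit)

    0μ : ∣ μ ∣ₒ
    0μ = Injection.to ℕ↣μ 0

    segment-≺ : ∀ a → ∣ μ ↓ a ∣ₒ ≺ ∣ μ ∣ₒ
    segment-≺ a = value↣ , isCardinal a

    module _ {X : Set} (X≺μ : X ≺ ∣ μ ∣ₒ) where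

      tower-≺ : ∀ k → Tower X k ≺ ∣ μ ∣ₒ
      tower-≺ zero    = X≺μ
      tower-≺ (suc k) = proj₂ (proj₂ strongLimit) (tower-≺ k)

      tower⇒↣ : InTower X A → A ↣ ∣ μ ∣ₒ
      tower⇒↣ (k , f) = proj₁ (tower-≺ k) ∘↣ f

      tower⇒¬↢ : InTower X A → ¬ (∣ μ ∣ₒ ↣ A)
      tower⇒¬↢ (k , f) g = proj₂ (tower-≺ k) (f ∘↣ g)

    -- Hessenberg's theorem.  In the order by (max, first, second) each proper
    -- initial segment of μ × μ lies in the square of one of μ, which is smaller
    -- than μ since μ is a strong limit.
    private
      Pair : Set
      Pair = ∣ μ ∣ₒ × ∣ μ ∣ₒ

      _⊔μ_ : ∣ μ ∣ₒ → ∣ μ ∣ₒ → ∣ μ ∣ₒ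
      x ⊔μ y with x ⊓⊔ y
      ... | inj₁ _ = y
      ... | inj₂ _ = x

      ≤-⊔ˡ : ∀ x y → x ≤ x ⊔μ y
      ≤-⊔ˡ x y with x ⊓⊔ y
      ... | inj₁ x≤y = x≤y
      ... | inj₂ _   = <-irrefl

      ≤-⊔ʳ : ∀ x y → y ≤ x ⊔μ y
      ≤-⊔ʳ x y with x ⊓⊔ y
      ... | inj₁ _   = <-irrefl
      ... | inj₂ y<x = <⇒≤ y<x

      key : Pair → ∣ μ ∣ₒ × Pair
      key (x , y) = x ⊔μ y , x , y

      _<ₗₑₓ_ : Rel (∣ μ ∣ₒ × Pair) 0ℓ
      _<ₗₑₓ_ = ×-Lex _≡_ _<_ (×-Lex _≡_ _<_ _<_)

      _<ₚ_ : Rel Pair 0ℓ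
      _<ₚ_ = _<ₗₑₓ_ on key

      wf : WellFounded _<ₚ_
      wf = On.wellFounded key (×-wellFounded wellFounded (×-wellFounded wellFounded wellFounded))

      connexₚ : ∀ v w → v ≢ w → v <ₚ w ⊎ w <ₚ v
      connexₚ v w v≢w with ×-compare {_<₂_ = ×-Lex _≡_ _<_ _<_} sym compare
                              (×-compare sym compare compare) (key v) (key w)
      ... | tri< l _ _ = inj₁ l
      ... | tri≈ _ (_ , refl , refl) _ = contradiction refl v≢w
      ... | tri> _ _ g = inj₂ g

      Below : ∣ μ ∣ₒ → Set
      Below m = Refinement ∣ μ ∣ₒ (_≤ m)

      below↣ : ∀ m → Below m ↣ (∣ μ ↓ m ∣ₒ ⊎ ⊤)
      below↣ m = mk↣ {to = λ x → to x em} λ {x} {y} → to-injective x y em em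
        where
        to : (x : Below m) → Dec (value x < m) → ∣ μ ↓ m ∣ₒ ⊎ ⊤
        to x (yes p) = inj₁ (value x ,′ p)
        to x (no _)  = inj₂ tt
        equal : (x : Below m) → ¬ (value x < m) → value x ≡ m
        equal x ¬p with compare (value x) m
        ... | tri< l _ _ = contradiction l ¬p
        ... | tri≈ _ e _ = e
        ... | tri> _ _ g = contradiction g (member x)
        to-injective : ∀ x y d d′ → to x d ≡ to y d′ → x ≡ y
        to-injective x y (yes _) (yes _) refl = refl
        to-injective x y (no p)  (no q)  _    = value-injective (trans (equal x p) (sym (equal y q)))

      ≤-max : ∀ {v w} → v <ₚ w → proj₁ v ≤ proj₁ (key w) × proj₂ v ≤ proj₁ (key w)
      ≤-max {x , y} {w} v<w = ≤-trans (≤-⊔ˡ x y) (max≤ v<w) , ≤-trans (≤-⊔ʳ x y) (max≤ v<w)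
        where
        max≤ : (x , y) <ₚ w → x ⊔μ y ≤ proj₁ (key w)
        max≤ (inj₁ l)       = <⇒≤ l
        max≤ (inj₂ (e , _)) = subst (x ⊔μ y ≤_) e <-irrefl

      room : ∀ w (h : Pair → ∣ μ ∣ₒ) → ∃[ x ] ¬ ⊥ × (∀ {v} → v <ₚ w → h v ≢ x)
      room w h = byContradiction λ ¬∃ →
        tower⇒¬↢ (segment-≺ m) (tower-× square square)
          (into ∘↣ surjection⇒↣ {A = Refinement Pair (_<ₚ w)} (h ∘ value) λ x →
            byContradiction λ ¬hit → ¬∃ (x , id , λ {v} p eq → ¬hit ((v ,′ p) , eq)))
        where
        m = proj₁ (key w)
        square : InTower ∣ μ ↓ m ∣ₒ (Below m)
        square = tower-↣ (below↣ m) (tower-⊎ (0 , mk↣ id) tower-⊤)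
        into : Refinement Pair (_<ₚ w) ↣ (Below m × Below m)
        into = mk↣ {to = λ v → (_ ,′ proj₁ (≤-max (member v))) , (_ ,′ proj₂ (≤-max (member v)))} λ eq →
          value-injective (cong₂ _,_ (cong (value ∘ proj₁) eq) (cong (value ∘ proj₂) eq))

    square↣ : (∣ μ ∣ₒ × ∣ μ ∣ₒ) ↣ ∣ μ ∣ₒ
    square↣ = mk↣ {to = mex} (mex-injective connexₚ)
      where open Mex μ 0μ wf (λ _ → ⊥) room

    Σ↣ : {P : A → Set} → A ↣ ∣ μ ∣ₒ → (∀ a → P a ↣ ∣ μ ∣ₒ) → Σ A P ↣ ∣ μ ∣ₒ
    Σ↣ {A} {P} f g = square↣ ∘↣ mk↣ {to = λ (a , p) → Injection.to f a , Injection.to (g a) p} λ eq →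
      equal (↣-injective f (cong proj₁ eq)) (cong proj₂ eq)
      where
      equal : ∀ {a a′ p p′} → a ≡ a′ → Injection.to (g a) p ≡ Injection.to (g a′) p′ → (a , p) ≡ (a′ , p′)
      equal refl eq = cong (_ ,_) (↣-injective (g _) eq)

    sum↣ : A ↣ ∣ μ ∣ₒ → B ↣ ∣ μ ∣ₒ → (A ⊎ B) ↣ ∣ μ ∣ₒ
    sum↣ f g = square↣ ∘↣ tag↣ ∘↣ (f ⊎↣ g)
      where
      tag↣ : (∣ μ ∣ₒ ⊎ ∣ μ ∣ₒ) ↣ (∣ μ ∣ₒ × ∣ μ ∣ₒ)
      tag↣ = mk↣ {to = to} to-injective
        where
        to : ∣ μ ∣ₒ ⊎ ∣ μ ∣ₒ → ∣ μ ∣ₒ × ∣ μ ∣ₒ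
        to (inj₁ x) = x , Injection.to ℕ↣μ 0
        to (inj₂ y) = y , Injection.to ℕ↣μ 1
        to-injective : ∀ {x y} → to x ≡ to y → x ≡ y
        to-injective {inj₁ _} {inj₁ _} eq = cong inj₁ (cong proj₁ eq)
        to-injective {inj₁ _} {inj₂ _} eq = contradiction (↣-injective ℕ↣μ (cong proj₂ eq)) λ ()
        to-injective {inj₂ _} {inj₁ _} eq = contradiction (↣-injective ℕ↣μ (cong proj₂ eq)) λ ()
        to-injective {inj₂ _} {inj₂ _} eq = cong inj₂ (cong proj₁ eq)

    module Successor (μ⁺ : Ordinal) (isSuccessor : IsSuccessorCardinal μ μ⁺) where
      private module μ⁺ = OrdinalProperties μ⁺

      0μ⁺ : ∣ μ⁺ ∣ₒ
      0μ⁺ = Injection.to (proj₁ (proj₁ (proj₂ isSuccessor))) 0μ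

      -- the least γ < μ⁺ with |γ| ≰ μ would be a cardinal strictly between μ and μ⁺
      segment⁺↣ : ∀ γ → ∣ μ⁺ ↓ γ ∣ₒ ↣ ∣ μ ∣ₒ
      segment⁺↣ γ = byContradiction λ ¬↣ →
        absurd (least μ⁺.wellFounded (λ γ → ¬ (∣ μ⁺ ↓ γ ∣ₒ ↣ ∣ μ ∣ₒ)) (γ , ¬↣))
        where
        absurd : ¬ (∃[ γ ] ¬ (∣ μ⁺ ↓ γ ∣ₒ ↣ ∣ μ ∣ₒ) ×
                    (∀ {β} → β μ⁺.< γ → ¬ ¬ (∣ μ⁺ ↓ β ∣ₒ ↣ ∣ μ ∣ₒ)))
        absurd (γ , large , minimal) = proj₁ isSuccessor γ μ⁺↣ν
          where
          ν : Ordinal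
          ν = μ⁺ ↓ γ
          ν-cardinal : IsCardinal ν
          ν-cardinal a f = minimal (member a) λ g → large (g ∘↣ value-segment↣ ∘↣ f)
            where
            value-segment↣ : ∣ ν ↓ a ∣ₒ ↣ ∣ μ⁺ ↓ value a ∣ₒ
            value-segment↣ = mk↣ {to = λ x → value (value x) ,′ member x} λ eq →
              value-injective (value-injective (cong value eq))
          ν₀ : ∣ ν ∣ₒ
          ν₀ = byContradiction λ ¬ν → large (mk↣ {to = λ x → ⊥-elim (¬ν x)} λ {x} _ → ⊥-elim (¬ν x))
          room′ : ∀ w (h : ∣ μ ∣ₒ → ∣ ν ∣ₒ) → ∃[ x ] ¬ ⊥ × (∀ {v} → v < w → h v ≢ x)
          room′ w h = byContradiction λ ¬∃ → large (value↣ ∘↣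
            surjection⇒↣ {A = ∣ μ ↓ w ∣ₒ} (h ∘ value)
            λ x → byContradiction λ ¬hit → ¬∃ (x , id , λ {v} p eq → ¬hit ((v ,′ p) , eq)))
          μ↣ν : ∣ μ ∣ₒ ↣ ∣ ν ∣ₒ
          μ↣ν = mk↣ {to = mex} (mex-injective (connex μ))
            where open Mex ν ν₀ wellFounded (λ _ → ⊥) room′
          μ⁺↣ν : ∣ μ⁺ ∣ₒ ↣ ∣ ν ∣ₒ
          μ⁺↣ν = ≼⇒↣ μ⁺ ν (proj₂ (proj₂ isSuccessor) ν ν-cardinal (μ↣ν , large))

      missing-value : A ↣ ∣ μ ∣ₒ → (h : A → ∣ μ⁺ ∣ₒ) → ∃[ x ] (∀ a → h a ≢ x)
      missing-value f h = byContradiction λ ¬∃ → proj₂ (proj₁ (proj₂ isSuccessor))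
        (f ∘↣ surjection⇒↣ h λ x → byContradiction λ ¬hit → ¬∃ (x , λ a eq → ¬hit (a , eq)))

      -- Regularity of `μ⁺`: the segments below the `h a` have at most `μ` points in all, and any
      -- point outside their union bounds every `h a`.
      bounded : A ↣ ∣ μ ∣ₒ → (h : A → ∣ μ⁺ ∣ₒ) → ∃[ γ ] (∀ a → h a μ⁺.≤ γ)
      bounded {A} f h = γ , λ a γ<ha → miss (a , (γ ,′ γ<ha)) refl
        where
        Points : Set
        Points = Σ A λ a → ∣ μ⁺ ↓ h a ∣ₒ
        point : Points → ∣ μ⁺ ∣ₒ
        point (_ , x) = value x
        points↣ : Points ↣ ∣ μ ∣ₒ
        points↣ = Σ↣ f (λ a → segment⁺↣ (h a))
        missing : ∃[ x ] (∀ p → point p ≢ x)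
        missing = missing-value points↣ point
        γ    = proj₁ missing
        miss = proj₂ missing

  module _ {τ : Vocabulary} {ℓ : Level} (𝔨 : AEC τ ℓ) where

    open Vocabulary τ
    open AEC 𝔨
    open IsEmbedding

    private variable
      L M N P : Structure τ

    -- Directed unions

    embedding-id : IsEmbedding M M id
    embedding-id = record { injective = id ; pres-fun = λ _ _ → refl ; pres-rel = λ _ _ → refl }

    embedding-factor : ∀ {f : ∣ L ∣ → ∣ M ∣} {g : ∣ M ∣ → ∣ N ∣} →
                       IsEmbedding L N (g ∘ f) → IsEmbedding M N g → IsEmbedding L M f
    embedding-factor {g = g} gf-emb g-emb = record
      { injective = λ eq → injective gf-emb (cong g eq)
      ; pres-fun  = λ s xs → injective g-emb (trans (pres-fun gf-emb s xs) (sym (pres-fun g-emb s _)))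
      ; pres-rel  = λ r xs → trans (pres-rel gf-emb r xs) (sym (pres-rel g-emb r _))
      }

    embedding-∘ : ∀ {f : ∣ L ∣ → ∣ M ∣} {g : ∣ M ∣ → ∣ N ∣} →
                  IsEmbedding L M f → IsEmbedding M N g → IsEmbedding L N (g ∘ f)
    embedding-∘ {g = g} f-emb g-emb = record
      { injective = λ eq → injective f-emb (injective g-emb eq)
      ; pres-fun  = λ s xs → trans (cong g (pres-fun f-emb s xs)) (pres-fun g-emb s _)
      ; pres-rel  = λ r xs → trans (pres-rel f-emb r xs) (pres-rel g-emb r _)
      }

    isomorphism-id : IsIsomorphism M M id
    isomorphism-id = embedding-id , λ x → x , refl

    ≤-resp-≗ : ∀ {f g} → f ≗ g → M ≤ N via f → M ≤ N via g
    ≤-resp-≗ f≗g = ≤-resp-≅ isomorphism-id isomorphism-id (λ x → sym (f≗g x))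

    isomorphism⇒≤ : ∀ {i} → IsIsomorphism M N i → K M → M ≤ N via i
    isomorphism⇒≤ iso k = ≤-resp-≅ isomorphism-id iso (λ _ → refl) (≤-refl k)

    ≤-coherence : ∀ {f : ∣ L ∣ → ∣ M ∣} {g : ∣ M ∣ → ∣ N ∣} →
                  M ≤ N via g → L ≤ N via (g ∘ f) → L ≤ M via f
    ≤-coherence g≤ gf≤ = coherence (embedding-factor (≤⇒⊆ gf≤) (≤⇒⊆ g≤)) g≤ gf≤

    module _ (N : Structure τ) (V : ∣ N ∣ → Set)
             (closed : ∀ s xs → (∀ k → V (xs k)) → V (Structure.fun N s xs)) where

      substructure : Structure τ
      substructure = ⟨ Refinement ∣ N ∣ V , record
        { fun = λ s xs → Structure.fun N s (value ∘ xs) ,′ closed s _ (λ k → member (xs k))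
        ; rel = λ r xs → Structure.rel N r (value ∘ xs) } ⟩

      substructure-embedding : IsEmbedding substructure N value
      substructure-embedding = record
        { injective = value-injective ; pres-fun = λ _ _ → refl ; pres-rel = λ _ _ → refl }

    ω : Ordinal
    ω = record
      { Carrier = ℕ ; _<_ = ℕ._<_
      ; isStrictTotalOrder = ℕ.<-isStrictTotalOrder ; wellFounded = ℕ.<-wellFounded }

    ω-limit : IsLimit ω
    ω-limit = 0 , λ n → suc n , ℕ.n<1+n n

    no-limit-below-ω : ∀ n → ¬ IsLimit (ω ↓ n)
    no-limit-below-ω zero    (x , _) with () ← member x
    no-limit-below-ω (suc n) (_ , above) with above (n ,′ ℕ.n<1+n n)
    ... | y , n<y = ℕ.<-irrefl refl (ℕ.<-≤-trans n<y (ℕ.s≤s⁻¹ (member y)))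

    -- Transition maps are not data. Where the maps `e t` are injective, a transition map is
    -- determined by commuting with them, so coherence of the system is automatic.
    module Family {C T : Set} (A : T → Structure τ) (e : ∀ s → ∣ A s ∣ → C) where

      infix 4 _⊑_
      _⊑_ : T → T → Set ℓ
      s ⊑ t = Σ (∣ A s ∣ → ∣ A t ∣) λ m → A s ≤ A t via m × e t ∘ m ≗ e s

      ⊑-trans : ∀ {r s t} → r ⊑ s → s ⊑ t → r ⊑ t
      ⊑-trans (m , m≤ , m≗) (n , n≤ , n≗) = n ∘ m , ≤-trans m≤ n≤ , λ x → trans (n≗ (m x)) (m≗ x)

      record IsDirected (_∨_ : T → T → T) : Set ℓ where
        field
          ⊑-∨ˡ : ∀ s t → s ⊑ s ∨ t
          ⊑-∨ʳ : ∀ s t → t ⊑ s ∨ t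

        ⊑-refl : ∀ {s} → s ⊑ s
        ⊑-refl {s} = id , ≤-refl (≤⇒Kˡ (proj₁ (proj₂ (⊑-∨ˡ s s)))) , λ _ → refl

        -- Bounds of finite families suffice because symbols have finite arity; the inhabitant of
        -- `V` serves the nullary ones.
        bound : ∀ {p} (V : T → Set p) → ∃ V → (∀ {s t} → V s → V t → V (s ∨ t)) →
                ∀ {n} (g : Fin n → T) → (∀ k → V (g k)) → ∃[ s ] V s × (∀ k → g k ⊑ s)
        bound V (s , v) _  {zero}  g gv = s , v , λ ()
        bound V inh join {suc n} g gv with bound V inh join (g ∘ suc) (gv ∘ suc)
        ... | s , v , below = g zero ∨ s , join (gv zero) v ,
          λ { zero → ⊑-∨ˡ _ _ ; (suc k) → ⊑-trans (below k) (⊑-∨ʳ _ _) }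

      -- All of `C` is interpreted, with the junk value `c₀` where no member supplies one. The
      -- result need not belong to `K`; the union is cut out of it as a substructure.
      module Ambient {_∨_ : T → T → T} (dir : IsDirected _∨_)
                     (e-injective : ∀ s → Injective _≡_ _≡_ (e s)) (c₀ : C) where
        open IsDirected dir

        private
          funGraph : (f : FunSym) → (Fin (funArity f) → C) → C → Set
          funGraph f cs c = ∃[ s ] ∃[ xs ] e s ∘ xs ≡ cs × e s (Structure.fun (A s) f xs) ≡ c

          relGraph : (r : RelSym) → (Fin (relArity r) → C) → Set
          relGraph r cs = ∃[ s ] ∃[ xs ] e s ∘ xs ≡ cs × Structure.rel (A s) r xs ≡ true

          fun-value : (f : FunSym) (cs : Fin (funArity f) → C) → Dec (∃ (funGraph f cs)) → C
          fun-value f cs (yes (c , _)) = c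
          fun-value f cs (no _)        = c₀

          same : ∀ {n s t} {xs : Fin n → ∣ A s ∣} {ys : Fin n → ∣ A t ∣} → e s ∘ xs ≡ e t ∘ ys →
                 (p : s ⊑ s ∨ t) (q : t ⊑ s ∨ t) → proj₁ p ∘ xs ≡ proj₁ q ∘ ys
          same eq (m , _ , m≗) (n , _ , n≗) = ext λ k →
            e-injective _ (trans (m≗ _) (trans (cong (λ h → h k) eq) (sym (n≗ _))))

        interpretation : Interpretation τ C
        interpretation = record
          { fun = λ f cs → fun-value f cs em
          ; rel = λ r cs → bool (relGraph r cs) }

        ambient : Structure τ
        ambient = ⟨ C , interpretation ⟩

        ambient-embedding : ∀ s → IsEmbedding (A s) ambient (e s)
        ambient-embedding s = record
          { injective = e-injective s
          ; pres-fun  = λ f xs → fun-lemma f xs em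
          ; pres-rel  = rel-lemma }
          where
          open ≡-Reasoning
          fun-lemma : ∀ f xs (d : Dec (∃ (funGraph f (e s ∘ xs)))) →
                      e s (Structure.fun (A s) f xs) ≡ fun-value f (e s ∘ xs) d
          fun-lemma f xs (no ¬g) = contradiction (_ , s , xs , refl , refl) ¬g
          fun-lemma f xs (yes (_ , t , ys , eq , refl)) with ⊑-∨ˡ s t in p | ⊑-∨ʳ s t in q
          ... | m , m≤ , m≗ | n , n≤ , n≗ = begin
            e s (Structure.fun (A s) f xs)             ≡⟨ m≗ _ ⟨
            e (s ∨ t) (m (Structure.fun (A s) f xs))   ≡⟨ cong (e _) (pres-fun (≤⇒⊆ m≤) f xs) ⟩
            e (s ∨ t) (Structure.fun (A (s ∨ t)) f (m ∘ xs))
              ≡⟨ cong (e _ ∘ Structure.fun (A (s ∨ t)) f) (same (sym eq) (m , m≤ , m≗) (n , n≤ , n≗)) ⟩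
            e (s ∨ t) (Structure.fun (A (s ∨ t)) f (n ∘ ys)) ≡⟨ cong (e _) (pres-fun (≤⇒⊆ n≤) f ys) ⟨
            e (s ∨ t) (n (Structure.fun (A t) f ys))   ≡⟨ n≗ _ ⟩
            e t (Structure.fun (A t) f ys)             ∎

          rel-lemma : ∀ r xs → Structure.rel (A s) r xs ≡ bool (relGraph r (e s ∘ xs))
          rel-lemma r xs with em {P = relGraph r (e s ∘ xs)}
          ... | no ¬g with Structure.rel (A s) r xs in eq
          ...   | true  = contradiction (s , xs , refl , eq) ¬g
          ...   | false = refl
          rel-lemma r xs | yes (t , ys , eq , holds) with ⊑-∨ˡ s t | ⊑-∨ʳ s t
          ... | m , m≤ , m≗ | n , n≤ , n≗ = begin
            Structure.rel (A s) r xs                ≡⟨ pres-rel (≤⇒⊆ m≤) r xs ⟩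
            Structure.rel (A (s ∨ t)) r (m ∘ xs)
              ≡⟨ cong (Structure.rel (A (s ∨ t)) r) (same (sym eq) (m , m≤ , m≗) (n , n≤ , n≗)) ⟩
            Structure.rel (A (s ∨ t)) r (n ∘ ys)    ≡⟨ pres-rel (≤⇒⊆ n≤) r ys ⟨
            Structure.rel (A t) r ys                ≡⟨ holds ⟩
            true                                    ∎

    module DirectedUnion (N : Structure τ) {T : Set} (A : T → Structure τ) (e : ∀ s → ∣ A s ∣ → ∣ N ∣)
                         (e-embedding : ∀ s → IsEmbedding (A s) N (e s))
                         {_∨_ : T → T → T} (dir : Family.IsDirected A e _∨_) where
      open Family A e
      open IsDirected dir

      record IsClosed (V : T → Set) : Set where
        field
          inhabited : ∃ V
          join      : ∀ {s t} → V s → V t → V (s ∨ t)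

      Hull : (T → Set) → ∣ N ∣ → Set
      Hull V c = ∃[ s ] V s × ∃[ x ] e s x ≡ c

      hull-closed : ∀ {V} → IsClosed V → ∀ f cs → (∀ k → Hull V (cs k)) → Hull V (Structure.fun N f cs)
      hull-closed {V} cl f cs hull
        with bound V inhabited join (λ k → proj₁ (hull k)) (λ k → proj₁ (proj₂ (hull k)))
        where open IsClosed cl
      ... | s , v , below = s , v , _ , trans (pres-fun (e-embedding s) f xs)
          (cong (Structure.fun N f) (ext λ k →
            trans (proj₂ (proj₂ (below k)) _) (proj₂ (proj₂ (proj₂ (hull k))))))
        where xs = λ k → proj₁ (below k) (proj₁ (proj₂ (proj₂ (hull k))))

      union : ∀ {V} → IsClosed V → Structure τ
      union {V} cl = substructure N (Hull V) (hull-closed cl)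

      module _ {V : T → Set} (cl : IsClosed V) where

        ι : ∀ s → V s → ∣ A s ∣ → ∣ union cl ∣
        ι s v x = e s x ,′ (s , v , x , refl)

        ι-embedding : ∀ s v → IsEmbedding (A s) (union cl) (ι s v)
        ι-embedding s v = embedding-factor (e-embedding s) (substructure-embedding N _ (hull-closed cl))

        -- The two union axioms, for the subsystem `V`. Both have to be carried through the
        -- induction: `smooth` for an earlier stage and `above` for a later one together give the
        -- embedding between the stages.
        record IsGood : Set (lsuc 0ℓ ⊔ ℓ) where
          field
            above  : ∀ s v → A s ≤ union cl via ι s v
            smooth : ∀ {P f} → IsEmbedding (union cl) P f →
                     (∀ s v → A s ≤ P via (f ∘ ι s v)) → union cl ≤ P via f

        module Covering (good : IsGood) (cover : ∀ c → Hull V c) where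
          open IsGood good

          private
            iso : IsIsomorphism (union cl) N value
            iso = substructure-embedding N _ (hull-closed cl) , λ c → (c ,′ cover c) , refl

          above-all : ∀ s → V s → A s ≤ N via e s
          above-all s v = ≤-trans (above s v) (isomorphism⇒≤ iso (≤⇒Kʳ (above s v)))

          locally-embedding : ∀ {f : ∣ N ∣ → ∣ P ∣} →
                              (∀ s → V s → IsEmbedding (A s) P (f ∘ e s)) → IsEmbedding N P f
          locally-embedding {P = P} {f} emb = record
            { injective = inj ; pres-fun = fun ; pres-rel = rel }
            where
            open IsClosed cl using (inhabited)
            covers : ∀ {n} (cs : Fin n → ∣ N ∣) → ∃[ s ] V s × ∃[ xs ] e s ∘ xs ≡ cs
            covers cs with bound V inhabited (IsClosed.join cl)
                             (λ k → proj₁ (cover (cs k))) (λ k → proj₁ (proj₂ (cover (cs k))))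
            ... | s , v , below =
              s , v , (λ k → proj₁ (below k) (proj₁ (proj₂ (proj₂ (cover (cs k)))))) ,
              ext λ k → trans (proj₂ (proj₂ (below k)) _) (proj₂ (proj₂ (proj₂ (cover (cs k)))))
            inj : Injective _≡_ _≡_ f
            -- Read as a tuple of length 2, the two points lie in one common member.
            inj {x} {y} eq with covers {2} (λ { zero → x ; (suc _) → y })
            ... | s , v , xs , xs≡ = trans (sym x≡) (trans (cong (e s) (injective (emb s v)
                  (trans (cong f x≡) (trans eq (cong f (sym y≡)))))) y≡)
              where
              x≡ = cong (λ cs → cs zero) xs≡
              y≡ = cong (λ cs → cs (suc zero)) xs≡
            fun : ∀ r cs → f (Structure.fun N r cs) ≡ Structure.fun P r (f ∘ cs)
            fun r cs with covers cs
            ... | s , v , xs , refl = trans (cong f (sym (pres-fun (e-embedding s) r xs))) (pres-fun (emb s v) r xs)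
            rel : ∀ r cs → Structure.rel N r cs ≡ Structure.rel P r (f ∘ cs)
            rel r cs with covers cs
            ... | s , v , xs , refl = trans (sym (pres-rel (e-embedding s) r xs)) (pres-rel (emb s v) r xs)

          smooth-all : ∀ {f} → (∀ s → V s → A s ≤ P via (f ∘ e s)) → N ≤ P via f
          smooth-all f≤ = ≤-resp-≅ iso isomorphism-id (λ _ → refl)
            (smooth (embedding-∘ (proj₁ iso) (locally-embedding λ s v → ≤⇒⊆ (f≤ s v))) f≤)

        countable-good : (v : ℕ → T) → (∀ n → V (v n)) → (∀ n → v n ⊑ v (suc n)) →
                         (∀ {s} → V s → ∃[ n ] s ⊑ v n) → IsGood
        countable-good v v∈V v⊑ cofinal = record
          { above  = λ s s∈V → let (n , m , m≤ , m≗) = cofinal s∈V in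
              ≤-resp-≗ (λ x → value-injective (m≗ x)) (≤-trans m≤ (v≤ n))
          ; smooth = λ f-emb f≤ → chain-smooth ω (A ∘ v) map inj ω-limit map≤ isUnion f-emb
              (λ n → f≤ (v n) (v∈V n))
          }
          where
          mono : ∀ {i j} → i ℕ.< j → v i ⊑ v j
          mono {i} {suc j} i<1+j with ℕ.m<1+n⇒m<n∨m≡n i<1+j
          ... | inj₁ i<j  = ⊑-trans (mono i<j) (v⊑ j)
          ... | inj₂ refl = v⊑ j
          map : ∀ {i j} → i ℕ.< j → ∣ A (v i) ∣ → ∣ A (v j) ∣
          map p = proj₁ (mono p)
          map≤ : ∀ {i j} (p : i ℕ.< j) → A (v i) ≤ A (v j) via map p
          map≤ p = proj₁ (proj₂ (mono p))
          inj : ∀ i → ∣ A (v i) ∣ → ∣ union cl ∣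
          inj i = ι (v i) (v∈V i)
          cover : ∀ x → ∃[ i ] ∃[ y ] inj i y ≡ x
          cover x with member x
          ... | s , s∈V , y , eq with cofinal s∈V
          ...   | n , m , _ , m≗ = n , m y , value-injective (trans (m≗ y) eq)
          isUnion : IsUnionOfChain ω (A ∘ v) map (union cl) inj
          isUnion = record
            { embedding  = λ i → ι-embedding (v i) (v∈V i)
            ; commute    = λ p x → value-injective (proj₂ (proj₂ (mono p)) x)
            ; cover      = cover
            ; continuous = λ j limit → contradiction limit (no-limit-below-ω j)
            }
          v≤ : ∀ i → A (v i) ≤ union cl via inj i
          v≤ = chain-union ω (A ∘ v) map inj ω-limit map≤ isUnion

      module _ (o : Ordinal) where
        open OrdinalProperties o hiding (≤-trans)

        -- Besides the generators `d x` with `x < a` there are countably many more, `c n`. They give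
        -- room for the induction: at a successor the last generator moves into `c`, which lowers
        -- `a`, and only the countable case and the limit case remain.
        data Closure (a : ∣ o ∣ₒ) (c : ℕ → T) (d : ∣ o ∣ₒ → T) : T → Set where
          early : ∀ n → Closure a c d (c n)
          late  : ∀ {x} → x < a → Closure a c d (d x)
          join  : ∀ {s t} → Closure a c d s → Closure a c d t → Closure a c d (s ∨ t)

        closure-closed : ∀ {a c d} → IsClosed (Closure a c d)
        closure-closed = record { inhabited = _ , early 0 ; join = join }

        closure-mono : ∀ {a b c d s} → a ≤ b → Closure a c d s → Closure b c d s
        closure-mono a≤b (early n)  = early n
        closure-mono a≤b (late x<a) = late (<-≤-trans x<a a≤b)
        closure-mono a≤b (join p q) = join (closure-mono a≤b p) (closure-mono a≤b q)

        closure-limit : ∀ {b c d s} → (∃[ x ] x < b) → (∀ {x} → x < b → ∃[ y ] x < y × y < b) →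
                        Closure b c d s → ∃[ a ] a < b × Closure a c d s
        closure-limit (x , x<b) lim (early n) = x , x<b , early n
        closure-limit inh lim (late x<b) with lim x<b
        ... | y , x<y , y<b = y , y<b , late x<y
        closure-limit inh lim (join p q) with closure-limit inh lim p | closure-limit inh lim q
        ... | a , a<b , p′ | a′ , a′<b , q′ with a ⊓⊔ a′
        ...   | inj₁ a≤a′ = a′ , a′<b , join (closure-mono a≤a′ p′) q′
        ...   | inj₂ a′<a = a , a<b , join p′ (closure-mono (<⇒≤ a′<a) q′)

        module CountableClosure {a : ∣ o ∣ₒ} {c : ℕ → T} {d : ∣ o ∣ₒ → T} (empty : ∀ {x} → ¬ (x < a)) where

          terms : ℕ → List T
          terms zero    = []
          terms (suc n) = c n ∷ terms n ++ cartesianProductWith _∨_ (terms n) (terms n)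

          terms-mono : ∀ {m n s} → m ℕ.≤′ n → s ∈ terms m → s ∈ terms n
          terms-mono ℕ.≤′-refl       s∈ = s∈
          terms-mono (ℕ.≤′-step m≤n) s∈ = there (∈-++⁺ˡ (terms-mono m≤n s∈))

          complete : ∀ {s} → Closure a c d s → ∃[ n ] s ∈ terms n
          complete (early n)  = suc n , here refl
          complete (late x<a) = contradiction x<a empty
          complete (join p q) with complete p | complete q
          ... | m , s∈ | n , t∈ = suc (m ℕ.+ n) , there (∈-++⁺ʳ (terms (m ℕ.+ n))
                (∈-cartesianProductWith⁺ _∨_
                  (terms-mono (ℕ.≤⇒≤′ (ℕ.m≤m+n m n)) s∈) (terms-mono (ℕ.≤⇒≤′ (ℕ.m≤n+m n m)) t∈)))

          sound : ∀ n {s} → s ∈ terms n → Closure a c d s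
          sound (suc n) (here refl) = early n
          sound (suc n) (there s∈) with ∈-++⁻ (terms n) s∈
          ... | inj₁ s∈′ = sound n s∈′
          ... | inj₂ s∈′ with ∈-cartesianProductWith⁻ _∨_ (terms n) (terms n) s∈′
          ...   | _ , _ , p , q , refl = join (sound n p) (sound n q)

          foldr-base : ∀ b l → b ⊑ foldr _∨_ b l
          foldr-base b []      = ⊑-refl
          foldr-base b (s ∷ l) = ⊑-trans (foldr-base b l) (⊑-∨ʳ s _)

          foldr-∈ : ∀ b {s} l → s ∈ l → s ⊑ foldr _∨_ b l
          foldr-∈ b (s ∷ l) (here refl) = ⊑-∨ˡ s _
          foldr-∈ b (s ∷ l) (there s∈)  = ⊑-trans (foldr-∈ b l s∈) (⊑-∨ʳ s _)

          foldr-closure : ∀ b l → Closure a c d b → (∀ {s} → s ∈ l → Closure a c d s) →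
                          Closure a c d (foldr _∨_ b l)
          foldr-closure b []      p h = p
          foldr-closure b (s ∷ l) p h = join (h (here refl)) (foldr-closure b l p (h ∘ there))

          -- The join yields upper bounds only, so an ascending cofinal sequence is built by folding
          -- in, at each step, the finitely many terms listed so far.
          cofinal : ℕ → T
          cofinal zero    = c 0
          cofinal (suc n) = foldr _∨_ (cofinal n) (terms n)

          cofinal-closure : ∀ n → Closure a c d (cofinal n)
          cofinal-closure zero    = early 0
          cofinal-closure (suc n) = foldr-closure _ _ (cofinal-closure n) (sound n)

          closure-⊑ : ∀ {s} → Closure a c d s → ∃[ n ] s ⊑ cofinal n
          closure-⊑ p with complete p
          ... | n , s∈ = suc n , foldr-∈ _ (terms n) s∈

        module LimitClosure {a : ∣ o ∣ₒ} {c : ℕ → T} {d : ∣ o ∣ₒ → T} 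
                 (inh : ∃[ x ] x < a) (lim : ∀ {x} → x < a → ∃[ y ] x < y × y < a)
                 (ih : ∀ {i} → i < a → IsGood (closure-closed {i} {c} {d}))
                 {V : T → Set} (cl : IsClosed V)
                 (to : ∀ {s} → V s → Closure a c d s) (from : ∀ {s} → Closure a c d s → V s) where

          δ : Ordinal
          δ = o ↓ a

          δ-limit : IsLimit δ
          δ-limit = (proj₁ inh ,′ proj₂ inh) ,
            λ x → let (y , x<y , y<a) = lim (member x) in (y ,′ y<a) , x<y

          stage : ∣ δ ∣ₒ → Structure τ
          stage i = union (closure-closed {value i} {c} {d})

          mono : ∀ {i j : ∣ δ ∣ₒ} → value i < value j → ∀ {x} →
                 Hull (Closure (value i) c d) x → Hull (Closure (value j) c d) x
          mono i<j (s , p , h) = s , closure-mono (<⇒≤ i<j) p , h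

          map : ∀ {i j : ∣ δ ∣ₒ} → value i < value j → ∣ stage i ∣ → ∣ stage j ∣
          map {i} {j} i<j = refine (λ {x} → mono {i} {j} i<j {x})

          top : ∀ {i : ∣ δ ∣ₒ} {x} → Hull (Closure (value i) c d) x → Hull V x
          top {i} (s , p , h) = s , from (closure-mono (<⇒≤ (member i)) p) , h

          inj : ∀ i → ∣ stage i ∣ → ∣ union cl ∣
          inj i = refine (λ {x} → top {i} {x})

          incl : ∀ {V} (cl : IsClosed V) → IsEmbedding (union cl) N value
          incl cl = substructure-embedding N _ (hull-closed cl)

          map≤ : ∀ {i j : ∣ δ ∣ₒ} (p : value i < value j) → stage i ≤ stage j via map {i} {j} p
          map≤ {i} {j} i<j = IsGood.smooth (ih (member i))
            (embedding-factor (incl closure-closed) (incl closure-closed))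
            λ s p → IsGood.above (ih (member j)) s (closure-mono (<⇒≤ i<j) p)

          covered : ∀ x → ∃[ i ] ∃[ y ] inj i y ≡ x
          covered (x , p) with member {P = Hull V} (x , p)
          ... | s , s∈V , h with closure-limit inh lim (to s∈V)
          ...   | i , i<a , q = (i ,′ i<a) , (x ,′ (s , q , h)) , refl

          continuous : ∀ j → IsLimit (δ ↓ j) → (x : ∣ stage j ∣) →
                       ∃[ i ] Σ (value i < value j) λ p → ∃[ y ] map {i} {j} p y ≡ x
          continuous j (i₀ , above) (x , p) with member {P = Hull (Closure (value j) c d)} (x , p)
          ... | s , s∈ , h with closure-limit (value (value i₀) , member i₀) lim-j s∈
            where
            lim-j : ∀ {x} → x < value j → ∃[ y ] x < y × y < value j
            lim-j {x} x<j with above ((x ,′ <-trans x<j (member j)) ,′ x<j)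
            ... | y , x<y = value (value y) , x<y , member y
          ...   | i , i<j , q = (i ,′ <-trans i<j (member j)) , i<j , (x ,′ (s , q , h)) , refl

          isUnion : IsUnionOfChain δ stage (λ {i} {j} → map {i} {j}) (union cl) inj
          isUnion = record
            { embedding  = λ i → embedding-factor (incl closure-closed) (incl cl)
            ; commute    = λ _ _ → refl
            ; cover      = covered
            ; continuous = continuous
            }

          limit-good : IsGood cl
          limit-good = record
            { above  = above
            ; smooth = λ f-emb f≤ → chain-smooth δ stage (λ {i} {j} → map {i} {j}) inj δ-limit
                (λ {i} {j} → map≤ {i} {j}) isUnion f-emb
                λ i → IsGood.smooth (ih (member i)) (embedding-∘ (IsUnionOfChain.embedding isUnion i) f-emb)
                  λ s p → f≤ s (from (closure-mono (<⇒≤ (member i)) p))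
            }
            where
            above : ∀ s v → A s ≤ union cl via ι cl s v
            above s v with closure-limit inh lim (to v)
            ... | i , i<a , p = ≤-trans (IsGood.above (ih i<a) s p)
              (chain-union δ stage (λ {i} {j} → map {i} {j}) inj δ-limit
                (λ {i} {j} → map≤ {i} {j}) isUnion (i ,′ i<a))

        -- `V` is only required to be equivalent to the closure, so the successor step can change
        -- the generators and still speak of the same union. At a limit the closures for smaller
        -- ordinals form a continuous chain, since an element of the closure involves finitely many
        -- generators.
        closure-good : ∀ a c d {V} (cl : IsClosed V) →
                       (∀ {s} → V s → Closure a c d s) → (∀ {s} → Closure a c d s → V s) → IsGood cl
        closure-good a = go (wellFounded a)
          where
          go : ∀ {a} → Acc _<_ a → ∀ c d {V} (cl : IsClosed V) →
               (∀ {s} → V s → Closure a c d s) → (∀ {s} → Closure a c d s → V s) → IsGood cl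
          go {a} (acc rs) c d {V} cl to from with em {P = ∃[ x ] x < a} | em {P = ∃[ p ] IsSuc o p a}
          ... | no empty | _ = countable-good cl cofinal (λ n → from (cofinal-closure n))
                                (λ n → foldr-base _ (terms n)) (closure-⊑ ∘ to)
            where open CountableClosure {a} {c} {d} (λ p → empty (_ , p))
          ... | yes _ | yes (p , p<a , next) = go (rs p<a) c′ d cl (push ∘ to) (from ∘ pull)
            where
            c′ : ℕ → T
            c′ zero    = d p
            c′ (suc n) = c n
            push : ∀ {s} → Closure a c d s → Closure p c′ d s
            push (early n)  = early (suc n)
            push (late {x} x<a) with compare x p
            ... | tri< x<p _ _  = late x<p
            ... | tri≈ _ refl _ = early 0
            ... | tri> _ _ p<x  = contradiction (p<x , x<a) (next x)
            push (join p q) = join (push p) (push q)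
            pull : ∀ {s} → Closure p c′ d s → Closure a c d s
            pull (early zero)    = late p<a
            pull (early (suc n)) = early n
            pull (late x<p)      = late (<-trans x<p p<a)
            pull (join p q)      = join (pull p) (pull q)
          ... | yes inh | no ¬suc = LimitClosure.limit-good inh lim
                  (λ i<a → go (rs i<a) c d closure-closed id id) cl to from
            where
            lim : ∀ {x} → x < a → ∃[ y ] x < y × y < a
            lim {x} x<a = byContradiction λ ¬∃ → ¬suc (x , x<a , λ y p → ¬∃ (y , p))

    -- The free index set with a binary join: a bound of two members is chosen by recursion on the
    -- tree, and the choices need not agree with each other.
    data Tree (X : Set) : Set where
      leaf : X → Tree X
      node : Tree X → Tree X → Tree X

    module TreeUnion (o : Ordinal) (x₀ : ∣ o ∣ₒ)
      (N : Structure τ) (A : Tree ∣ o ∣ₒ → Structure τ) (e : ∀ s → ∣ A s ∣ → ∣ N ∣)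
      (e-embedding : ∀ s → IsEmbedding (A s) N (e s))
      (dir : Family.IsDirected A e node) where

      open DirectedUnion N A e e-embedding dir public

      all-closed : IsClosed (λ _ → ⊤)
      all-closed = record { inhabited = leaf x₀ , tt ; join = λ _ _ → tt }

      private
        early-leaf : ℕ → Tree ∣ o ∣ₒ
        early-leaf _ = leaf x₀

        late-leaf : ∣ o +1 ∣ₒ → Tree ∣ o ∣ₒ
        late-leaf [ x ] = leaf x
        late-leaf ⊤⁺    = leaf x₀

        -- The segment of `o +1` below its top is all of `o`, so each leaf is a late generator.
        generated : ∀ s → Closure (o +1) ⊤⁺ early-leaf late-leaf s
        generated (leaf x)   = late [ x ]<⊤⁺
        generated (node s t) = join (generated s) (generated t)

      all-good : IsGood all-closed
      all-good = closure-good (o +1) ⊤⁺ early-leaf late-leaf all-closed (λ _ → generated _) (λ _ → tt)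

    -- Ultrapowers

    tabulate-injective : ∀ {n} {f g : Fin n → A} → tabulate f ≡ tabulate g → f ≗ g
    tabulate-injective eq zero    = ∷-injectiveˡ eq
    tabulate-injective eq (suc k) = tabulate-injective (∷-injectiveʳ eq) k

    -- The sum that `IsLSTBound` injects into `LST`. Its summand `ℕ` marks the facts that merely say
    -- that a name occurs in the universe.
    Tag : Set
    Tag = FunSym ⊎ RelSym ⊎ ℕ

    Tag↣LST : Tag ↣ LST
    Tag↣LST = proj₁ LST-bound

    ℕ↣LST : ℕ ↣ LST
    ℕ↣LST = Tag↣LST ∘↣ mk↣ {to = inj₂ ∘ inj₂} (λ eq → inj₂-injective (inj₂-injective eq))

    record Cover {N : Structure τ} (q : E → ∣ N ∣) : Set (lsuc 0ℓ ⊔ ℓ) where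
      field
        model     : Structure τ
        inc       : ∣ model ∣ → ∣ N ∣
        inc≤      : model ≤ N via inc
        lift      : E → ∣ model ∣
        inc-lift  : ∀ x → inc (lift x) ≡ q x
        size      : ∣ model ∣ ↣ (E ⊎ LST)

    LST-cover : ∀ {N} → K N → (q : E → ∣ N ∣) → Cover {N = N} q
    LST-cover {E} {N} k q with proj₂ LST-bound k (value↣ {P = λ n → ∃[ x ] q x ≡ n})
    ... | M , f , M≤N , covers , small = record
      { model = M ; inc = f ; inc≤ = M≤N
      ; lift = λ x → proj₁ (covers (q x ,′ (x , refl)))
      ; inc-lift = λ x → proj₂ (covers (q x ,′ (x , refl)))
      ; size = (image↣ ⊎↣ mk↣ id) ∘↣ small }
      where
      image↣ : Refinement ∣ N ∣ (λ n → ∃[ x ] q x ≡ n) ↣ E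
      image↣ = mk↣ {to = proj₁ ∘ member} λ {r} {r′} eq → value-injective
        (trans (sym (proj₂ (member r))) (trans (cong q eq) (proj₂ (member r′))))

    -- Diagrams of structures with named points.

    Code : Set → Set
    Code R = Tag × List R → Bool

    module _ (B : Structure τ) (c : ∣ B ∣ → R) where

      Fact : Tag × List R → Set
      Fact (inj₁ f , l)        = ∃[ xs ] l ≡ c (Structure.fun B f xs) ∷ tabulate (c ∘ xs)
      Fact (inj₂ (inj₁ r) , l) = ∃[ xs ] l ≡ tabulate (c ∘ xs) × Structure.rel B r xs ≡ true
      Fact (inj₂ (inj₂ _) , l) = ∃[ x ] l ≡ c x ∷ []

      -- the diagram of the isomorphic copy of B along c
      code : Code R
      code t = bool (Fact t)

    module _ (B B′ : Structure τ) {c : ∣ B ∣ → R} {c′ : ∣ B′ ∣ → R}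
             (c-inj : Injective _≡_ _≡_ c) (c′-inj : Injective _≡_ _≡_ c′)
             (same : code B c ≡ code B′ c′) where
      private
        to : ∀ t → Fact B c t → Fact B′ c′ t
        to t p = bool-sound (trans (cong (λ h → h t) (sym same)) (bool-true p))

        from : ∀ t → Fact B′ c′ t → Fact B c t
        from t p = bool-sound (trans (cong (λ h → h t) same) (bool-true p))

        θ : ∣ B ∣ → ∣ B′ ∣
        θ x = proj₁ (to (inj₂ (inj₂ 0) , c x ∷ []) (x , refl))

        θ-code : ∀ x → c′ (θ x) ≡ c x
        θ-code x = sym (∷-injectiveˡ (proj₂ (to (inj₂ (inj₂ 0) , c x ∷ []) (x , refl))))

        θ-fun : ∀ s xs → θ (Structure.fun B s xs) ≡ Structure.fun B′ s (θ ∘ xs)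
        θ-fun s xs with to (inj₁ s , _) (xs , refl)
        ... | ys , eq = c′-inj (trans (θ-code _) (trans (∷-injectiveˡ eq)
              (cong (c′ ∘ Structure.fun B′ s) (sym θxs≡ys))))
          where
          θxs≡ys : θ ∘ xs ≡ ys
          θxs≡ys = ext λ k → c′-inj (trans (θ-code _) (tabulate-injective (∷-injectiveʳ eq) k))

        θ-rel : ∀ r xs → Structure.rel B r xs ≡ Structure.rel B′ r (θ ∘ xs)
        θ-rel r xs with Structure.rel B r xs in eq | Structure.rel B′ r (θ ∘ xs) in eq′
        ... | true  | true  = refl
        ... | false | false = refl
        ... | true  | false with to (inj₂ (inj₁ r) , _) (xs , refl , eq)
        ...   | ys , l , holds = trans (sym holds) (trans (cong (Structure.rel B′ r)
                (ext λ k → c′-inj (trans (sym (tabulate-injective l k)) (sym (θ-code _))))) eq′)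
        θ-rel r xs | false | true with from (inj₂ (inj₁ r) , _) (θ ∘ xs , refl , eq′)
        ...   | ys , l , holds = trans (sym eq) (trans (cong (Structure.rel B r)
                (ext λ k → c-inj (trans (sym (θ-code _)) (tabulate-injective l k)))) holds)

      -- Facts about the universe match the points that have the same name; the facts about
      -- functions and relations make this matching an isomorphism.
      code-isomorphism : ∃[ θ ] IsIsomorphism B B′ θ × c′ ∘ θ ≗ c
      code-isomorphism = θ , (record
        { injective = λ eq → c-inj (trans (sym (θ-code _)) (trans (cong c′ eq) (θ-code _)))
        ; pres-fun = θ-fun ; pres-rel = θ-rel }
        , λ y → let (x , eq) = from (inj₂ (inj₂ 0) , c′ y ∷ []) (y , refl)
                in x , c′-inj (trans (θ-code x) (sym (∷-injectiveˡ eq))))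
        , θ-code

    -- Ultrafilters and smallness.

    record IsUltrafilter {I : Set} (D : Pred (Pred I 0ℓ) 0ℓ) : Set₁ where
      field
        nonempty : ∀ {P} → D P → ∃ P
        upward   : ∀ {P Q} → (∀ {i} → P i → Q i) → D P → D Q
        meet     : ∀ {P Q} → D P → D Q → D (λ i → P i × Q i)
        ultra    : ∀ P → D P ⊎ D (λ i → ¬ P i)

    module Smallness {I : Set} {D : Pred (Pred I 0ℓ) 0ℓ} (isUltrafilter : IsUltrafilter D) where
      open IsUltrafilter isUltrafilter public

      everywhere : {P : I → Set} → (∀ i → P i) → D P
      everywhere {P} p with ultra P
      ... | inj₁ d = d
      ... | inj₂ d with nonempty d
      ...   | i , ¬p = contradiction (p i) ¬p

      -- For an ultrafilter on a measurable κ, this says |Q| < κ.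
      Small : Set → Set
      Small Q = (f : I → Q) → ∃[ q ] D (λ i → f i ≡ q)

      small-↣ : A ↣ B → Small B → Small A
      small-↣ g small f with small (Injection.to g ∘ f)
      ... | b , d with nonempty d
      ...   | i , eq = f i , upward (λ eq′ → ↣-injective g (trans eq′ (sym eq))) d

      small-⊤ : Small ⊤
      small-⊤ f = tt , everywhere λ _ → refl

      small-⊥ : Small ⊥
      small-⊥ f = ⊥-elim (f (proj₁ (nonempty (everywhere {P = λ _ → ⊤} λ _ → tt))))

      small-Bool : Small Bool
      small-Bool f with ultra (λ i → f i ≡ true)
      ... | inj₁ d = true , d
      ... | inj₂ d = false , upward not-true d
        where
        not-true : ∀ {i} → ¬ (f i ≡ true) → f i ≡ false
        not-true {i} ne with f i
        ... | true  = contradiction refl ne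
        ... | false = refl

      -- The first coordinate is fixed almost everywhere, then the second. Where the first differs
      -- from `q`, the value at `i₀` stands in for the second.
      small-Σ : {R : Q → Set} → Small Q → (∀ q → Small (R q)) → Small (Σ Q R)
      small-Σ {Q} {R} smallQ smallR f with smallQ (proj₁ ∘ f)
      ... | q , d with nonempty d
      ...   | i₀ , eq₀ with smallR q (λ i → second (f i) em)
        where
        second : (p : Σ Q R) → Dec (proj₁ p ≡ q) → R q
        second (_ , r) (yes refl) = r
        second _       (no _)     = subst R eq₀ (proj₂ (f i₀))
      ... | r , d′ = (q , r) , upward (λ {i} p → both {i} p) (meet d d′)
        where
        both : ∀ {i} → _ → f i ≡ (q , r)
        both {i} (eq , eq′) with f i | em {P = proj₁ (f i) ≡ q}
        both {i} (refl , refl) | _ , _ | yes refl = refl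
        ... | _ | no ne = contradiction eq ne

      small-⊎ : Small A → Small B → Small (A ⊎ B)
      small-⊎ {A} {B} a b = small-↣ (mk↣ {to = to} to-injective) (small-Σ {R = Side} small-Bool small)
        where
        Side : Bool → Set
        Side true  = A
        Side false = B
        small : ∀ x → Small (Side x)
        small true  = a
        small false = b
        to : A ⊎ B → Σ Bool Side
        to (inj₁ x) = true , x
        to (inj₂ y) = false , y
        to-injective : ∀ {x y} → to x ≡ to y → x ≡ y
        to-injective {inj₁ _} {inj₁ _} refl = refl
        to-injective {inj₂ _} {inj₂ _} refl = refl

      -- Otherwise, sending `i` to an index that fails at `i` gives a map with a single value `j`
      -- almost everywhere, against `d j`.
      complete : {A : J → I → Set} → Small J → (∀ j → D (A j)) → D (λ i → ∀ j → A j i)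
      complete {J} {A} small d with ultra (λ i → ∀ j → A j i)
      ... | inj₁ d∀  = d∀
      ... | inj₂ d¬∀ with small (λ i → fails i em)
        where
        fails : ∀ i → Dec (∃[ j ] ¬ A j i) → J
        fails i (yes (j , _)) = j
        fails i (no _)        = proj₁ (¬∀⇒∃¬ (proj₂ (nonempty d¬∀)))
      ... | j , d′ with nonempty (meet d¬∀ (meet d′ (d j)))
      ...   | i , ¬all , eq , holds with em {P = ∃[ j ] ¬ A j i}
      ...     | yes (j′ , ¬a) = contradiction (subst (λ j → A j i) (sym eq) holds) ¬a
      ...     | no ¬∃         = contradiction (¬∀⇒∃¬ ¬all) ¬∃

      -- Each coordinate is constant on a large set, and the intersection of these sets is large.
      -- With `R = Bool` this is the proof that a measurable cardinal is a strong limit.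
      small-→ : Small Q → Small R → Small (Q → R)
      small-→ smallQ smallR f =
        (λ q → proj₁ (smallR (λ i → f i q))) ,
        upward (λ eq → ext eq) (complete smallQ λ q → proj₂ (smallR (λ i → f i q)))

    -- Small models inside the ultrapower.

    module Ultraproduct {I : Set} {D : Pred (Pred I 0ℓ) 0ℓ} (isUltrafilter : IsUltrafilter D)
      (small-LST : Smallness.Small isUltrafilter LST)
      {M : Structure τ} (kM : K M) (m₀ : ∣ M ∣) where
      open Smallness isUltrafilter

      small-× : Small A → Small B → Small (A × B)
      small-× a b = small-Σ a λ _ → b

      small-Code : Small R → Small (Code R)
      small-Code r = small-→ (small-× (small-↣ Tag↣LST small-LST)
        (small-↣ list↣ (small-→ (small-↣ ℕ↣LST small-LST) (small-⊎ small-⊤ r)))) small-Bool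

      infix 4 _∼_
      _∼_ : (I → ∣ M ∣) → (I → ∣ M ∣) → Set
      f ∼ g = D (λ i → f i ≡ g i)

      -- Equivalent functions have equal Bool-valued classes, so picking from the class is canonical.
      private
        pick : (χ : (I → ∣ M ∣) → Bool) → Dec (∃[ g ] χ g ≡ true) → I → ∣ M ∣
        pick χ (yes (g , _)) = g
        pick χ (no _)        = λ _ → m₀

      rep : (I → ∣ M ∣) → I → ∣ M ∣
      rep f = pick (λ g → bool (f ∼ g)) em

      rep-∼ : ∀ f → f ∼ rep f
      rep-∼ f = lemma em
        where
        lemma : ∀ d → f ∼ pick (λ g → bool (f ∼ g)) d
        lemma (yes (g , eq)) = bool-sound eq
        lemma (no ¬∃)        = contradiction (f , bool-true (everywhere λ _ → refl)) ¬∃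

      rep-cong : ∀ {f g} → f ∼ g → rep f ≡ rep g
      rep-cong f∼g = cong (λ χ → pick χ em) (ext λ h → bool-cong
        (λ f∼h → upward (λ (p , q) → trans (sym p) q) (meet f∼g f∼h))
        (λ g∼h → upward (λ (p , q) → trans p q) (meet f∼g g∼h)))

      rep-sound : ∀ {f g} → rep f ≡ rep g → f ∼ g
      rep-sound {f} {g} eq = upward (λ {i} (p , q) → trans p (trans (cong (λ h → h i) eq) (sym q)))
        (meet (rep-∼ f) (rep-∼ g))

      -- `D` measures predicates in `Set`, while `≤` takes values in `Set ℓ`. The large set of
      -- coordinates that are ≤-embeddings is therefore recorded through a witness `Valid`.
      record Member : Set (lsuc 0ℓ ⊔ ℓ) where
        field
          model  : Structure τ
          small  : Small ∣ model ∣
          coord  : I → ∣ model ∣ → ∣ M ∣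
          Valid  : I → Set
          valid  : D Valid
          coord≤ : ∀ {i} → Valid i → model ≤ M via coord i

        class : ∣ model ∣ → I → ∣ M ∣
        class x = rep (λ i → coord i x)

        class-injective : Injective _≡_ _≡_ class
        class-injective eq with nonempty (meet valid (rep-sound eq))
        ... | i , v , eq′ = injective (≤⇒⊆ (coord≤ v)) eq′

      open Member

      record UpperBound {J : Set} (ms : J → Member) : Set (lsuc 0ℓ ⊔ ℓ) where
        field
          bound    : Member
          to       : ∀ j → ∣ model (ms j) ∣ → ∣ model bound ∣
          to≤      : ∀ j → model (ms j) ≤ model bound via to j
          to-class : ∀ j → class bound ∘ to j ≗ class (ms j)

      module _ {J : Set} (small-J : Small J) (ms : J → Member) where
        private
          Dom : Set
          Dom = Σ J λ j → ∣ model (ms j) ∣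

          q : ∀ i → Dom → ∣ M ∣
          q i (j , x) = coord (ms j) i x

          cover-of : ∀ i → Cover {N = M} (q i)
          cover-of i = LST-cover kM (q i)

          module C (i : I) = Cover (cover-of i)

          Ran : Set
          Ran = Dom ⊎ LST

          c : ∀ i → ∣ C.model i ∣ → Ran
          c i = Injection.to (C.size i)

          small-Dom : Small Dom
          small-Dom = small-Σ small-J λ j → small (ms j)

          small-Ran : Small Ran
          small-Ran = small-⊎ small-Dom small-LST

          pattern-of : I → Code Ran × (Dom → Ran)
          pattern-of i = code (C.model i) (c i) , c i ∘ C.lift i

          abstract
            constant : ∃[ q ] D (λ i → pattern-of i ≡ q)
            constant = small-× (small-Code small-Ran) (small-→ small-Dom small-Ran) pattern-of

          W : I → Set
          W i = pattern-of i ≡ proj₁ constant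

          W∈D : D W
          W∈D = proj₂ constant

          abstract
            -- The index must be valid for all members at once: at that coordinate the members and
            -- their bound all map into `M`, and coherence there gives `to≤`.
            generic : ∃[ i ] W i × (∀ j → Valid (ms j) i)
            generic = nonempty (meet W∈D (complete small-J λ j → valid (ms j)))

          i₀ : I
          i₀ = proj₁ generic

          w₀ : W i₀
          w₀ = proj₁ (proj₂ generic)

          iso : ∀ {i} → W i → ∃[ θ ] IsIsomorphism (C.model i₀) (C.model i) θ × c i ∘ θ ≗ c i₀
          iso {i} w = code-isomorphism (C.model i₀) (C.model i)
            (↣-injective (C.size i₀)) (↣-injective (C.size i)) (cong proj₁ (trans w₀ (sym w)))

          e : ∀ i → Dec (W i) → ∣ C.model i₀ ∣ → ∣ M ∣
          e i (yes w) = C.inc i ∘ proj₁ (iso w)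
          e i (no _)  = C.inc i₀

          e≤ : ∀ i (w? : Dec (W i)) → W i → C.model i₀ ≤ M via e i w?
          e≤ i (yes w) _ = ≤-trans (isomorphism⇒≤ (proj₁ (proj₂ (iso w))) (≤⇒Kˡ (C.inc≤ i₀))) (C.inc≤ i)
          e≤ i (no ¬w) w = contradiction w ¬w

          e∘d : ∀ i (w? : Dec (W i)) → W i → ∀ j x → e i w? (C.lift i₀ (j , x)) ≡ coord (ms j) i x
          e∘d i (no ¬w) w j x = contradiction w ¬w
          e∘d i (yes w) _ j x = trans (cong (C.inc i) (↣-injective (C.size i)
            (trans (proj₂ (proj₂ (iso w)) _) (cong (λ q → proj₂ q (j , x)) (trans w₀ (sym w))))))
            (C.inc-lift i (j , x))

          top : Member
          top = record
            { model = C.model i₀ ; small = small-↣ (C.size i₀) small-Ran ; coord = λ i → e i em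
            ; Valid = W ; valid = W∈D ; coord≤ = λ {i} → e≤ i em }

        -- In every coordinate the images of all members are covered by a Löwenheim-Skolem submodel
        -- of `M`. With points named in `Ran`, both its diagram and the places of the covered points
        -- are constant almost everywhere, so one of these submodels represents them all.
        upper-bound : UpperBound ms
        upper-bound = record
          { bound    = top
          ; to       = λ j x → C.lift i₀ (j , x)
          ; to≤      = λ j → ≤-coherence (C.inc≤ i₀) (≤-resp-≗ (λ x → sym (C.inc-lift i₀ (j , x)))
                         (coord≤ (ms j) (proj₂ (proj₂ generic) j)))
          ; to-class = λ j x → rep-cong (upward (λ {i} w → e∘d i em w j x) W∈D)
          }

      record Approximation (N : Structure τ) : Set (lsuc 0ℓ ⊔ ℓ) where
        field
          part  : I → Structure τ
          incl  : ∀ i → ∣ part i ∣ → ∣ N ∣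
          incl≤ : ∀ i → part i ≤ N via incl i
          img   : ∀ i → ∣ part i ∣ → ∣ M ∣
          img≤  : ∀ i → part i ≤ M via img i
          cover : ∀ n → D (λ i → ∃[ x ] incl i x ≡ n)

        private
          extend-at : ∀ i n → Dec (∃[ x ] incl i x ≡ n) → ∣ M ∣
          extend-at i n (yes (x , _)) = img i x
          extend-at i n (no _)        = m₀

          extend-at-incl : ∀ i x d → extend-at i (incl i x) d ≡ img i x
          extend-at-incl i x (yes (y , eq)) = cong (img i) (injective (≤⇒⊆ (incl≤ i)) eq)
          extend-at-incl i x (no ¬∃)        = contradiction (x , refl) ¬∃

        extend : I → ∣ N ∣ → ∣ M ∣
        extend i n = extend-at i n em

        extend-incl : ∀ i x → extend i (incl i x) ≡ img i x
        extend-incl i x = extend-at-incl i x em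

        limit-map : ∣ N ∣ → I → ∣ M ∣
        limit-map n = rep (λ i → extend i n)

        -- Completeness puts the whole of the small model `A` inside `part i` for almost every `i`;
        -- there coherence turns `A ≤ N` into `A ≤ part i`, and `img` carries it into `M`.
        restrict : ∀ {A a} → A ≤ N via a → Small ∣ A ∣ → Member
        restrict {A} {a} A≤N small-A = record
          { model  = A
          ; small  = small-A
          ; coord  = λ i → extend i ∘ a
          ; Valid  = λ i → ∀ x → ∃[ y ] incl i y ≡ a x
          ; valid  = complete small-A λ x → cover (a x)
          ; coord≤ = λ {i} lift → ≤-resp-≗
              (λ x → trans (sym (extend-incl i _)) (cong (extend i) (proj₂ (lift x))))
              (≤-trans (≤-coherence (incl≤ i) (≤-resp-≗ (λ x → sym (proj₂ (lift x))) A≤N)) (img≤ i))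
          }

      -- Amalgamation inside the ultrapower.

      module Amalgam (N : Bool → Structure τ) (kN : ∀ l → K (N l)) (approx : ∀ l → Approximation (N l))
        (o : Ordinal) (x₀ : ∣ o ∣ₒ)
        (enum : ∀ l → ∣ o ∣ₒ → ∣ N l ∣) (enum-onto : ∀ l n → ∃[ x ] enum l x ≡ n) where
        private module App (l : Bool) = Approximation (approx l)
        open App

        -- Small submodels of N true and N false, mapped into a common small submodel
        -- of the ultrapower.
        record Node : Set (lsuc 0ℓ ⊔ ℓ) where
          field
            sub       : Bool → Structure τ
            inc       : ∀ l → ∣ sub l ∣ → ∣ N l ∣
            inc≤      : ∀ l → sub l ≤ N l via inc l
            small-sub : ∀ l → Small ∣ sub l ∣
            top       : Member
            up        : ∀ l → ∣ sub l ∣ → ∣ model top ∣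
            up≤       : ∀ l → sub l ≤ model top via up l
            up-class  : ∀ l x → class top (up l x) ≡ limit-map l (inc l x)

        open Node

        module _ {E : Bool → Set} (small-E : ∀ l → Small (E l)) (q : ∀ l → E l → ∣ N l ∣)
                 {J : Set} (small-J : Small J) (ms : J → Member) where
          private
            cover-of : ∀ l → Cover {N = N l} (q l)
            cover-of l = LST-cover (kN l) (q l)

            module C (l : Bool) = Cover (cover-of l)

            small-C : ∀ l → Small ∣ C.model l ∣
            small-C l = small-↣ (C.size l) (small-⊎ (small-E l) small-LST)

            members : J ⊎ Bool → Member
            members (inj₁ j) = ms j
            members (inj₂ l) = restrict l (C.inc≤ l) (small-C l)

            ub : UpperBound members
            ub = upper-bound (small-⊎ small-J small-Bool) members

            module U = UpperBound ub

          -- The bound is taken over the given members and the restrictions of both submodels, so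
          -- that both sides and all earlier tops end up in one model.
          covering-node : Node
          covering-node = record
            { sub = C.model ; inc = C.inc ; inc≤ = C.inc≤ ; small-sub = small-C ; top = U.bound
            ; up = λ l → U.to (inj₂ l) ; up≤ = λ l → U.to≤ (inj₂ l)
            ; up-class = λ l → U.to-class (inj₂ l) }

          covering-lift : ∀ l x → ∃[ y ] inc covering-node l y ≡ q l x
          covering-lift l x = C.lift l x , C.inc-lift l x

          covering-⊑ : ∀ j → Σ (∣ model (ms j) ∣ → ∣ model (top covering-node) ∣) λ m →
                       model (ms j) ≤ model (top covering-node) via m ×
                       class (top covering-node) ∘ m ≗ class (ms j)
          covering-⊑ j = U.to (inj₁ j) , U.to≤ (inj₁ j) , U.to-class (inj₁ j)

        leaf-node : ∣ o ∣ₒ → Node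
        leaf-node x = covering-node (λ _ → small-⊤) (λ l _ → enum l x) small-⊥ (λ ())

        module _ (n n′ : Node) where
          parts : Bool → Set
          parts l = ∣ sub n l ∣ ⊎ ∣ sub n′ l ∣

          small-parts : ∀ l → Small (parts l)
          small-parts l = small-⊎ (small-sub n l) (small-sub n′ l)

          inc-parts : ∀ l → parts l → ∣ N l ∣
          inc-parts l = Sum.[ inc n l , inc n′ l ]

          tops : Bool → Member
          tops b = top (if b then n else n′)

          join-node : Node
          join-node = covering-node small-parts inc-parts small-Bool tops

          join-lift : ∀ l x → ∃[ y ] inc join-node l y ≡ inc-parts l x
          join-lift = covering-lift small-parts inc-parts small-Bool tops

          join-⊑ : ∀ b → Σ (∣ model (tops b) ∣ → ∣ model (top join-node) ∣) λ m →
                   model (tops b) ≤ model (top join-node) via m ×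
                   class (top join-node) ∘ m ≗ class (tops b)
          join-⊑ = covering-⊑ small-parts inc-parts small-Bool tops

        value-at : Tree ∣ o ∣ₒ → Node
        value-at (leaf x)   = leaf-node x
        value-at (node s t) = join-node (value-at s) (value-at t)

        module Sub (l : Bool) = Family (λ s → sub (value-at s) l) (λ s → inc (value-at s) l)

        sub-directed : ∀ l → Sub.IsDirected l node
        sub-directed l = record
          { ⊑-∨ˡ = λ s t → below s t (inc≤ (value-at s) l) inj₁ λ _ → refl
          ; ⊑-∨ʳ = λ s t → below s t (inc≤ (value-at t) l) inj₂ λ _ → refl }
          where
          below : ∀ s t {A a} → A ≤ N l via a →
                  (side : ∣ A ∣ → ∣ sub (value-at s) l ∣ ⊎ ∣ sub (value-at t) l ∣) →
                  Sum.[ inc (value-at s) l , inc (value-at t) l ] ∘ side ≗ a →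
                  Σ (∣ A ∣ → ∣ sub (value-at (node s t)) l ∣) λ m →
                  A ≤ sub (value-at (node s t)) l via m × inc (value-at (node s t)) l ∘ m ≗ a
          below s t A≤N side side≗ = _ ,
            ≤-coherence (inc≤ (value-at (node s t)) l) (≤-resp-≗ (λ x → sym (covers x)) A≤N) , covers
            where covers = λ x → trans (proj₂ (join-lift (value-at s) (value-at t) l (side x))) (side≗ x)

        module Top = Family (λ s → model (top (value-at s))) (λ s → class (top (value-at s)))

        top-directed : Top.IsDirected node
        top-directed = record
          { ⊑-∨ˡ = λ s t → join-⊑ (value-at s) (value-at t) true
          ; ⊑-∨ʳ = λ s t → join-⊑ (value-at s) (value-at t) false }

        open Top.Ambient top-directed (λ s → class-injective (top (value-at s))) (λ _ → m₀)

        module TopUnion = TreeUnion o x₀ ambient _ _ ambient-embedding top-directed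

        amalgam : Structure τ
        amalgam = TopUnion.union TopUnion.all-closed

        module SubUnion (l : Bool) = TreeUnion o x₀ (N l) _ _ (λ s → ≤⇒⊆ (inc≤ (value-at s) l)) (sub-directed l)

        sub-covers : ∀ l n → SubUnion.Hull l (λ _ → ⊤) n
        sub-covers l n with enum-onto l n
        ... | x , refl = leaf x , tt , covering-lift (λ _ → small-⊤) (λ l _ → enum l x) small-⊥ (λ ()) l tt

        into-amalgam : ∀ l → ∣ N l ∣ → ∣ amalgam ∣
        into-amalgam l n = limit-map l n ,′ in-hull (sub-covers l n)
          where
          in-hull : SubUnion.Hull l (λ _ → ⊤) n → TopUnion.Hull (λ _ → ⊤) (limit-map l n)
          in-hull (s , _ , y , refl) = s , tt , up (value-at s) l y , up-class (value-at s) l y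

        -- By smoothness it is enough to embed each small `sub`, which goes through its `top`;
        -- `up-class` says that these embeddings agree with the single map `limit-map`.
        into-amalgam≤ : ∀ l → N l ≤ amalgam via into-amalgam l
        into-amalgam≤ l = SubUnion.Covering.smooth-all l
          (SubUnion.all-closed l) (SubUnion.all-good l) (sub-covers l)
          λ s _ → ≤-resp-≗ (λ x → value-injective (up-class (value-at s) l x))
            (≤-trans (up≤ (value-at s) l) (TopUnion.IsGood.above TopUnion.all-good s tt))

        amalgamation : Σ (Structure τ) λ P → Σ (∀ l → ∣ N l ∣ → ∣ P ∣) λ g →
                       (∀ l → N l ≤ P via g l) ×
                       (∀ {l l′ n n′} → D (λ i → extend l i n ≡ extend l′ i n′) → g l n ≡ g l′ n′)
        amalgamation = amalgam , into-amalgam , into-amalgam≤ , λ eq → value-injective (rep-cong eq)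

    -- Structures on the ordinals in [μ, μ⁺)

    module _ (N : Structure τ) {C : Set} (φ : ∣ N ∣ ↔ C) where
      open Inverse φ using (to; from; strictlyInverseˡ; strictlyInverseʳ)

      transport : Interpretation τ C
      transport = record
        { fun = λ s xs → to (Structure.fun N s (from ∘ xs))
        ; rel = λ r xs → Structure.rel N r (from ∘ xs) }

      transport-isomorphism : IsIsomorphism N ⟨ C , transport ⟩ to
      transport-isomorphism = record
        { injective = ↣-injective (↔⇒↣ φ)
        ; pres-fun = λ s xs → cong (to ∘ Structure.fun N s) (ext λ k → sym (strictlyInverseʳ (xs k)))
        ; pres-rel = λ r xs → cong (Structure.rel N r) (ext λ k → sym (strictlyInverseʳ (xs k))) } ,
        λ c → from c , strictlyInverseˡ c

    module OrdStructures (μ : Ordinal) (strongLimit : IsStrongLimit μ)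
                         (μ⁺ : Ordinal) (isSuccessor : IsSuccessorCardinal μ μ⁺) where
      open StrongLimit μ strongLimit
      open Successor μ⁺ isSuccessor
      open OrdinalProperties μ⁺ hiding (≤-trans)
      open OrdStructure using (universe; structure)
      private module μ = OrdinalProperties μ

      OrdStr : Set
      OrdStr = OrdStructure 𝔨 μ⁺

      infix 4 _⊴_
      _⊴_ : OrdStr → OrdStr → Set ℓ
      _⊴_ = _≤ₒ_ 𝔨 μ⁺

      Dom : OrdStr → Set ℓ
      Dom = InDom 𝔨 μ⁺ μ

      include : ∀ {M N} → M ⊴ N → ∣ structure M ∣ → ∣ structure N ∣
      include (p , _) = refine (λ {x} → p {x})

      ⊴-refl : ∀ {M} → Dom M → M ⊴ M
      ⊴-refl (k , _) = (λ p → p) , ≤-refl k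

      ⊴-trans : ∀ {M N P} → M ⊴ N → N ⊴ P → M ⊴ P
      ⊴-trans (p , M≤N) (q , N≤P) = (λ x → q (p x)) , ≤-trans M≤N N≤P

      ≼-segment : ∀ {α β} → α ≤ β → μ ≼ (μ⁺ ↓ α) → μ ≼ (μ⁺ ↓ β)
      ≼-segment α≤β (f , increasing , initial) = Injection.to (segment↣ α≤β) ∘ f , increasing ,
        λ {x} {z} z<fx → let (y , eq) = initial {x} {value z ,′ <-trans z<fx (member (f x))} z<fx
                         in y , value-injective (cong value eq)

      dom-size : ∀ {M} → Dom M → ∣ structure M ∣ ↔ ∣ μ ∣ₒ
      dom-size {M} (_ , μ≼M) =
          cantor-schröder-bernstein (segment⁺↣ (universe M)) (≼⇒↣ μ (μ⁺ ↓ universe M) μ≼M)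

      -- The structures need only be comparable, in no relation to the order of their indices, so
      -- the padded sequences of `Saturation` qualify. As `γ` is the least upper bound of the
      -- universes, the union fills the segment below it.
      module ChainBound (c : ∣ μ ∣ₒ → OrdStr) (dom : ∀ i → Dom (c i))
                        (total : ∀ i j → c i ⊴ c j ⊎ c j ⊴ c i) where
        private
          abstract
            supremum : ∃[ γ ] (∀ i → universe (c i) ≤ γ) × (∀ {x} → x < γ → ¬ (∀ i → universe (c i) ≤ x))
            supremum = least wellFounded (λ γ → ∀ i → universe (c i) ≤ γ) (bounded (mk↣ id) (universe ∘ c))

          γ : ∣ μ⁺ ∣ₒ
          γ = proj₁ supremum

          larger : ∀ {i j} → c i ⊴ c j ⊎ c j ⊴ c i → ∣ μ ∣ₒ
          larger {j = j} (inj₁ _) = j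
          larger {i = i} (inj₂ _) = i

          index : Tree ∣ μ ∣ₒ → ∣ μ ∣ₒ
          index (leaf i)   = i
          index (node s t) = larger (total (index s) (index t))

          above : ∀ i → universe (c i) ≤ γ
          above = proj₁ (proj₂ supremum)

          inc : ∀ s → ∣ structure (c (index s)) ∣ → ∣ μ⁺ ↓ γ ∣ₒ
          inc s = refine (λ x<u → <-≤-trans x<u (above (index s)))

          open Family (structure ∘ c ∘ index) inc

          ⊴⇒⊑ : ∀ {s t} → c (index s) ⊴ c (index t) → s ⊑ t
          ⊴⇒⊑ M⊴N = include M⊴N , proj₂ M⊴N , λ _ → refl

          larger-ˡ : ∀ {i j} (tot : c i ⊴ c j ⊎ c j ⊴ c i) → c i ⊴ c (larger tot)
          larger-ˡ (inj₁ le) = le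
          larger-ˡ (inj₂ _)  = ⊴-refl (dom _)

          larger-ʳ : ∀ {i j} (tot : c i ⊴ c j ⊎ c j ⊴ c i) → c j ⊴ c (larger tot)
          larger-ʳ (inj₁ _)  = ⊴-refl (dom _)
          larger-ʳ (inj₂ le) = le

          directed : IsDirected node
          directed = record
            { ⊑-∨ˡ = λ s t → ⊴⇒⊑ {s} {node s t} (larger-ˡ (total (index s) (index t)))
            ; ⊑-∨ʳ = λ s t → ⊴⇒⊑ {t} {node s t} (larger-ʳ (total (index s) (index t))) }

          open Ambient directed (λ s eq → value-injective (cong value eq))
                       (inc (leaf 0μ) (proj₁ (proj₂ (dom 0μ)) 0μ))
          open TreeUnion μ 0μ ambient _ inc ambient-embedding directed

          covers : ∀ x → Hull (λ _ → ⊤) x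
          covers x with ¬∀⇒∃¬ (proj₂ (proj₂ supremum) (member x))
          ... | i , ¬¬p = leaf i , tt , (value x ,′ byContradiction ¬¬p) , refl

        bound : OrdStr
        bound = record { universe = γ ; interpretation = interpretation }

        bound-above : ∀ i → c i ⊴ bound
        bound-above i = (λ x<u → <-≤-trans x<u (above i)) ,
          Covering.above-all all-closed all-good covers (leaf i) tt

        bound-dom : Dom bound
        bound-dom = ≤⇒Kʳ (proj₂ (bound-above 0μ)) , ≼-segment (above 0μ) (proj₂ (dom 0μ))

      module Realise {Q : OrdStr} (dom : Dom Q) {N : Structure τ} (size : ∣ N ∣ ↔ ∣ μ ∣ₒ)
                     {f : ∣ structure Q ∣ → ∣ N ∣} (Q≤N : structure Q ≤ N via f) where
        private
          γ : ∣ μ⁺ ∣ₒ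
          γ = universe Q

          New : Set
          New = Refinement ∣ N ∣ (λ n → ¬ (∃[ q ] f q ≡ n))

          position : New ↣ ∣ μ ∣ₒ
          position = ↔⇒↣ size ∘↣ value↣

          infix 4 _<New_
          _<New_ : Rel New 0ℓ
          _<New_ = μ._<_ on Injection.to position

          New-wf : WellFounded _<New_
          New-wf = On.wellFounded (Injection.to position) μ.wellFounded

          values : (New → ∣ μ⁺ ∣ₒ) → ∣ μ⁺ ↓ γ ∣ₒ ⊎ New → ∣ μ⁺ ∣ₒ
          values h = Sum.[ value , h ]

          abstract
            fresh : (h : New → ∣ μ⁺ ∣ₒ) → ∃[ x ] ¬ (x < γ) × (∀ r → h r ≢ x)
            fresh h = proj₁ unused , (λ x<γ → proj₂ unused (inj₁ (proj₁ unused ,′ x<γ)) refl) ,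
              λ r → proj₂ unused (inj₂ r)
              where
              unused : ∃[ x ] (∀ z → values h z ≢ x)
              unused = missing-value (sum↣ (segment⁺↣ γ) position) (values h)

          room : (w : New) (h : New → ∣ μ⁺ ∣ₒ) → ∃[ x ] ¬ (x < γ) × (∀ {v} → v <New w → h v ≢ x)
          room w h = proj₁ (fresh h) , proj₁ (proj₂ (fresh h)) , λ {v} _ → proj₂ (proj₂ (fresh h)) v

          open Mex μ⁺ 0μ⁺ New-wf (_< γ) room

          abstract
            first-unused : ∃[ x ] (γ ≤ x × (∀ r → mex r ≢ x)) ×
                                  (∀ {y} → y < x → ¬ (γ ≤ y × (∀ r → mex r ≢ y)))
            first-unused = least wellFounded (λ x → γ ≤ x × (∀ r → mex r ≢ x)) (fresh mex)

          γ′ : ∣ μ⁺ ∣ₒ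
          γ′ = proj₁ first-unused

          γ≤γ′ : γ ≤ γ′
          γ≤γ′ = proj₁ (proj₁ (proj₂ first-unused))

          mex<γ′ : ∀ r → mex r < γ′
          mex<γ′ r = ≤-≢⇒< (λ γ′<r → let (v , eq) = mex-least r γ′<r γ≤γ′
                                     in proj₂ (proj₁ (proj₂ first-unused)) v eq)
                           (proj₂ (proj₁ (proj₂ first-unused)) r)

          old : ∣ structure Q ∣ → ∣ μ⁺ ↓ γ′ ∣ₒ
          old = refine (λ x<γ → <-≤-trans x<γ γ≤γ′)

          place : ∀ n → Dec (∃[ q ] f q ≡ n) → ∣ μ⁺ ↓ γ′ ∣ₒ
          place n (yes (q , _)) = old q
          place n (no ¬q)       = mex (n ,′ ¬q) ,′ mex<γ′ (n ,′ ¬q)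

          place-injective : ∀ n n′ d d′ → place n d ≡ place n′ d′ → n ≡ n′
          place-injective n n′ (yes (q , e)) (yes (q′ , e′)) eq =
            trans (sym e) (trans (cong f (value-injective (cong value eq))) e′)
          place-injective n n′ (yes (q , _)) (no _)  eq =
            contradiction (subst (_< γ) (cong value eq) (member q)) (mex-avoids _)
          place-injective n n′ (no _) (yes (q , _))  eq =
            contradiction (subst (_< γ) (sym (cong value eq)) (member q)) (mex-avoids _)
          place-injective n n′ (no _) (no _) eq =
            cong value (mex-injective (λ v w v≢w → connex μ _ _ (v≢w ∘ ↣-injective position)) (cong value eq))

          place-old : ∀ q d → place (f q) d ≡ old q
          place-old q (yes (q′ , eq)) = cong old (injective (≤⇒⊆ Q≤N) eq)
          place-old q (no ¬q)         = contradiction (q , refl) ¬q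

          place-new : ∀ (r : New) d → value (place (value r) d) ≡ mex r
          place-new r (yes q) = contradiction q (member r)
          place-new r (no _)  = refl

          surjective : ∀ x → ∃[ n ] place n em ≡ x
          surjective x with em {P = value x < γ}
          ... | yes x<γ = f (value x ,′ x<γ) , trans (place-old _ em) refl
          ... | no ¬x<γ with em {P = ∃[ r ] mex r ≡ value x}
          ...   | yes (r , eq) = value r , value-injective (trans (place-new r em) eq)
          ...   | no ¬∃        = contradiction (¬x<γ , λ r eq → ¬∃ (r , eq))
                                     (proj₂ (proj₂ first-unused) (member x))

          φ : ∣ N ∣ ↔ ∣ μ⁺ ↓ γ′ ∣ₒ
          φ = bijection (λ n → place n em) (place-injective _ _ em em) surjective

        realised : OrdStr
        realised = record { universe = γ′ ; interpretation = transport N φ }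

        realise : ∣ N ∣ → ∣ structure realised ∣
        realise n = place n em

        realise-isomorphism : IsIsomorphism N (structure realised) realise
        realise-isomorphism = transport-isomorphism N φ

        ⊴-realised : Q ⊴ realised
        ⊴-realised = (λ x<γ → <-≤-trans x<γ γ≤γ′) ,
          ≤-resp-≅ isomorphism-id realise-isomorphism (λ q → sym (place-old q em)) Q≤N

        realise-old : ∀ q → realise (f q) ≡ include ⊴-realised q
        realise-old q = place-old q em

        realised-dom : Dom realised
        realised-dom = ≤⇒Kʳ (proj₂ ⊴-realised) , ≼-segment γ≤γ′ (proj₂ dom)

      -- Extensions that decide every task.

      module Saturation {p : Level} {Task : Set} (number : Task ↣ ∣ μ ∣ₒ) (Realizes : Task → OrdStr → Set p)
                        (persistent : ∀ {t M N} → M ⊴ N → Realizes t M → Realizes t N)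
                        (M : OrdStr) (dom : Dom M) where

        Decided : Task → OrdStr → Set (ℓ ⊔ p)
        Decided t Q = ∀ {N} → Dom N → Q ⊴ N → Realizes t N → Realizes t Q

        -- This makes one pass through the tasks enough: what is decided at its own step remains so
        -- in every later model.
        decided-persistent : ∀ {t Q N} → Q ⊴ N → Decided t Q → Decided t N
        decided-persistent Q⊴N decided domP N⊴P r = persistent Q⊴N (decided domP (⊴-trans Q⊴N N⊴P) r)

        private
          ν : Task → ∣ μ ∣ₒ
          ν = Injection.to number

          record Good (i : ∣ μ ∣ₒ) (h : ∣ μ ∣ₒ → OrdStr) (Q : OrdStr) : Set (ℓ ⊔ p) where
            field
              in-dom  : Dom Q
              base    : M ⊴ Q
              earlier : ∀ {j} → j μ.< i → h j ⊴ Q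
              decides : ∀ t → ν t ≡ i → Decided t Q

          open Good

          good-local : ∀ {i h h′ Q} → (∀ {j} → j μ.< i → h j ≡ h′ j) → Good i h Q → Good i h′ Q
          good-local eq g = record
            { in-dom = in-dom g ; base = base g ; decides = decides g
            ; earlier = λ j<i → subst (_⊴ _) (eq j<i) (earlier g j<i) }

          open ChoiceRecursion μ.wellFounded M Good good-local

          -- The chain below `i`, padded with `M`. The entry at `i` itself is `M`, which puts the
          -- bound above `M` even at the first step.
          before : ∣ μ ∣ₒ → ∀ j {i} → Dec (j μ.< i) → OrdStr
          before _ j (yes _) = sequence j
          before _ j (no _)  = M

          -- At most one task has number `i`. Either some extension realizes it and is taken, or
          -- none does and `Q` has decided it vacuously.
          decide : ∀ i Q → Dom Q → Σ OrdStr λ N → Dom N × Q ⊴ N × (∀ t → ν t ≡ i → Decided t N)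
          decide i Q domQ with em {P = Σ OrdStr λ N → Dom N × Q ⊴ N × ∃[ t ] ν t ≡ i × Realizes t N}
          ... | yes (N , domN , Q⊴N , t , eq , r) = N , domN , Q⊴N , λ t′ eq′ _ _ _ →
                  subst (λ t → Realizes t N) (↣-injective number (trans eq (sym eq′))) r
          ... | no ¬∃ = Q , domQ , ⊴-refl domQ , λ t eq {N} domN Q⊴N r →
                  contradiction (N , domN , Q⊴N , t , eq , r) ¬∃

          module Step (i : ∣ μ ∣ₒ) (ih : ∀ {j} → j μ.< i → Good j sequence (sequence j)) where

            c : ∣ μ ∣ₒ → OrdStr
            c j = before i j {i} em

            c-dom : ∀ j (d : Dec (j μ.< i)) → Dom (before i j d)
            c-dom j (yes j<i) = in-dom (ih j<i)
            c-dom j (no _)    = dom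

            c-total : ∀ j k (d : Dec (j μ.< i)) (d′ : Dec (k μ.< i)) →
                      before i j d ⊴ before i k d′ ⊎ before i k d′ ⊴ before i j d
            c-total j k (no _)    d         = inj₁ (base′ k d)
              where
              base′ : ∀ k d → M ⊴ before i k d
              base′ k (yes k<i) = base (ih k<i)
              base′ k (no _)    = ⊴-refl dom
            c-total j k (yes j<i) (no _)    = inj₂ (base (ih j<i))
            c-total j k (yes j<i) (yes k<i) with μ.compare j k
            ... | tri< j<k _ _  = inj₁ (earlier (ih k<i) j<k)
            ... | tri≈ _ refl _ = inj₁ (⊴-refl (in-dom (ih j<i)))
            ... | tri> _ _ k<j  = inj₂ (earlier (ih j<i) k<j)

            open ChainBound c (λ j → c-dom j em) (λ j k → c-total j k em em)

            c-before : ∀ {j} → j μ.< i → (d : Dec (j μ.< i)) → before i j d ≡ sequence j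
            c-before j<i (yes _) = refl
            c-before j<i (no ¬p) = contradiction j<i ¬p

            c-base : ∀ (d : Dec (i μ.< i)) → before i i d ≡ M
            c-base (yes p) = contradiction p μ.<-irrefl
            c-base (no _)  = refl

            next : Σ OrdStr λ N → Dom N × bound ⊴ N × (∀ t → ν t ≡ i → Decided t N)
            next = decide i bound bound-dom

            bound⊴next : bound ⊴ proj₁ next
            bound⊴next = proj₁ (proj₂ (proj₂ next))

            good : Good i sequence (proj₁ next)
            good = record
              { in-dom  = proj₁ (proj₂ next)
              ; base    = ⊴-trans (subst (_⊴ bound) (c-base em) (bound-above i)) bound⊴next
              ; earlier = λ {j} j<i → ⊴-trans (subst (_⊴ bound) (c-before j<i em) (bound-above j)) bound⊴next
              ; decides = proj₂ (proj₂ (proj₂ next)) }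

          all-good : ∀ i → Good i sequence (sequence i)
          all-good i = go (μ.wellFounded i)
            where
            go : ∀ {i} → Acc μ._<_ i → Good i sequence (sequence i)
            go {i} (acc rs) = sequence-good i (_ , Step.good i λ j<i → go (rs j<i))

          total : ∀ i j → sequence i ⊴ sequence j ⊎ sequence j ⊴ sequence i
          total i j with μ.compare i j
          ... | tri< i<j _ _  = inj₁ (earlier (all-good j) i<j)
          ... | tri≈ _ refl _ = inj₁ (⊴-refl (in-dom (all-good i)))
          ... | tri> _ _ j<i  = inj₂ (earlier (all-good i) j<i)

          open ChainBound sequence (λ i → in-dom (all-good i)) total

        saturated : Σ OrdStr λ Q → Dom Q × M ⊴ Q × (∀ t → Decided t Q)
        saturated = bound , bound-dom , ⊴-trans (base (all-good 0μ)) (bound-above 0μ) ,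
          λ t → decided-persistent (bound-above (ν t)) (decides (all-good (ν t)) t refl)

    -- The main construction

    module Main (μ κ : Ordinal) (strongLimit : IsStrongLimit μ) (cofinality : IsCofinality κ μ)
                (LST≺κ : LST ≺ ∣ κ ∣ₒ) (measurable : IsMeasurable κ) where
      open StrongLimit μ strongLimit
      open OrdStructure using (universe; structure)

      private
        module κ = OrdinalProperties κ
        module μ = OrdinalProperties μ

        U : Pred (Pred ∣ κ ∣ₒ 0ℓ) 0ℓ
        U = proj₁ (proj₂ (proj₂ measurable))

        open IsCompleteNonprincipalUltrafilter (proj₂ (proj₂ (proj₂ measurable)))

        Bool≺κ : Bool ≺ ∣ κ ∣ₒ
        Bool≺κ = proj₁ ℕ≺κ ∘↣ Bool↣ℕ , λ f → proj₂ ℕ≺κ (Bool↣ℕ ∘↣ f)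
          where
          ℕ≺κ : ℕ ≺ ∣ κ ∣ₒ
          ℕ≺κ = proj₁ (proj₂ measurable)
          Bool↣ℕ : Bool ↣ ℕ
          Bool↣ℕ = section↣ (ℕ._≡ᵇ 0) (λ b → if b then 0 else 1) (λ { true → refl ; false → refl })

        U-isUltrafilter : IsUltrafilter U
        U-isUltrafilter = record
          { nonempty = λ {P} d → byContradiction λ ¬∃ → proper (upward (λ {i} p → ¬∃ (i , p)) d)
          ; upward   = λ P⇒Q → upward (λ {i} → P⇒Q {i})
          ; meet     = λ {P} {Q} p q → upward (λ {i} both → both true , both false)
                         (complete Bool≺κ (λ b i → if b then P i else Q i)
                           λ { true → p ; false → q })
          ; ultra    = ultra }

        module U = Smallness U-isUltrafilter

        -- If no fibre of `f` were large, all their complements would be, and by κ-completeness so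
        -- would the intersection of these, which is empty.
        ≺⇒small : ∀ {Q} → Q ≺ ∣ κ ∣ₒ → U.Small Q
        ≺⇒small {Q} Q≺κ f = byContradiction λ ¬const → proper (upward (λ {i} off → off (f i) refl)
          (complete Q≺κ (λ q i → ¬ (f i ≡ q)) λ q →
            Sum.[ (λ d → contradiction (q , d) ¬const) , id ] (ultra (λ i → f i ≡ q))))

        -- The order of the quantifiers matters: a position in the enumeration of a stage exists
        -- only once `α` is chosen, and almost every `i` must exceed it.
        D : Pred (Pred (∣ κ ∣ₒ × ∣ κ ∣ₒ) 0ℓ) 0ℓ
        D P = U (λ α → U (λ i → P (α , i)))

        D-isUltrafilter : IsUltrafilter D
        D-isUltrafilter = record
          { nonempty = λ d → let (α , d′) = U.nonempty d ; (i , p) = U.nonempty d′ in (α , i) , p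
          ; upward   = λ P⇒Q → U.upward (U.upward P⇒Q)
          ; meet     = λ p q → U.upward (λ (p′ , q′) → U.meet p′ q′) (U.meet p q)
          ; ultra    = D-ultra }
          where
          D-ultra : ∀ P → D P ⊎ D (λ i → ¬ P i)
          D-ultra P = Sum.map id
            (U.upward λ {α} ¬d → Sum.[ (λ d → contradiction d ¬d) , id ] (ultra (λ i → P (α , i))))
            (ultra λ α → U (λ i → P (α , i)))

        D-small : ∀ {Q} → U.Small Q → Smallness.Small D-isUltrafilter Q
        D-small {Q} small f = proj₁ (small limit) ,
          U.upward (λ {α} eq → U.upward (λ e → trans e eq) (proj₂ (row α))) (proj₂ (small limit))
          where
          row : ∀ α → ∃[ q ] U (λ i → f (α , i) ≡ q)
          row α = small (λ i → f (α , i))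
          limit : ∣ κ ∣ₒ → Q
          limit α = proj₁ (row α)

        tail : ∀ j → U (j κ.<_)
        tail j = upward (λ {i} (ne , below) → κ.≤-≢⇒< (λ i<j → below (i ,′ i<j) refl) ne)
          (U.meet (avoid j) (complete (value↣ , proj₁ measurable j) (λ x i → value x ≢ i) λ x → avoid (value x)))
          where
          avoid : ∀ x → U (x ≢_)
          avoid x = Sum.[ (λ d → contradiction d (nonprincipal x)) , id ] (ultra (x ≡_))

        next : ∀ α → ∃[ β ] IsSuc κ α β
        next α = κ.succ α (U.nonempty (tail α))

        κ≼μ : κ ≼ μ
        κ≼μ = proj₂ cofinality μ (id , λ x → x , μ.<-irrefl)

        κ↣μ : ∣ κ ∣ₒ ↣ ∣ μ ∣ₒ
        κ↣μ = ≼⇒↣ κ μ κ≼μ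

        -- Almost every ordinal below κ lies above all the fewer than κ ordinals that represent
        -- `LST`; any such ordinal yields a segment of κ, and hence of μ, that contains `LST`.
        LST-segment : ∃[ a ] (LST ↣ ∣ μ ↓ a ∣ₒ)
        LST-segment with U.nonempty (complete LST≺κ (λ l i → Injection.to (proj₁ LST≺κ) l κ.< i) λ l → tail _)
        ... | α , bound = proj₁ κ≼μ α , mk↣
              {to = λ l → Injection.to κ↣μ (Injection.to (proj₁ LST≺κ) l) ,′ proj₁ (proj₂ κ≼μ) (bound l)}
              λ eq → ↣-injective (proj₁ LST≺κ) (↣-injective κ↣μ (cong value eq))

        θ : ∣ κ ∣ₒ → ∣ μ ∣ₒ
        θ = proj₁ (proj₁ cofinality)

        -- The first clause yields `y-exceeds`. The second puts a copy of `LST` below `y i`, so that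
        -- iterated power sets of `Initial i` alone bound the number of codes.
        Height : ∣ κ ∣ₒ → ∣ μ ∣ₒ → Set
        Height i y = (∀ {j} → j κ.< i → θ j μ.< y) × proj₁ LST-segment μ.≤ y

        abstract
          -- The restriction of `θ` to `i` is not cofinal in μ: otherwise κ would embed in its own
          -- segment below `i`. A bound is then raised to contain `LST`.
          height : ∀ i → ∃ (Height i)
          height i = raise (byContradiction λ ¬∃ → proj₁ measurable i
            (≼⇒↣ κ (κ ↓ i) (proj₂ cofinality (κ ↓ i) (θ ∘ value , λ y → escape y λ all → ¬∃ (y , all)))))
            where
            escape : ∀ y → ¬ (∀ {j} → j κ.< i → θ j μ.< y) → ∃[ j ] ¬ (θ (value {P = κ._< i} j) μ.< y)
            escape y ¬all = byContradiction λ ¬∃ → ¬all λ {j} j<i → byContradiction λ ¬< → ¬∃ ((j ,′ j<i) , ¬<)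
            raise : (∃[ y ] (∀ {j} → j κ.< i → θ j μ.< y)) → ∃ (Height i)
            raise (y , above) with y μ.⊓⊔ proj₁ LST-segment
            ... | inj₁ y≤a = _ , (λ j<i → μ.<-≤-trans (above j<i) y≤a) , μ.<-irrefl
            ... | inj₂ a<y = y , above , μ.<⇒≤ a<y

        y : ∣ κ ∣ₒ → ∣ μ ∣ₒ
        y i = proj₁ (height i)

        y-exceeds : ∀ x → U (λ i → x μ.< y i)
        y-exceeds x with proj₂ (proj₁ cofinality) x
        ... | j , x≤θj = upward (λ {i} j<i → μ.≤-<-trans x≤θj (proj₁ (proj₂ (height i)) j<i)) (tail j)

        Initial : ∣ κ ∣ₒ → Set
        Initial i = ∣ μ ↓ y i ∣ₒ

        LST↣Initial : ∀ i → LST ↣ Initial i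
        LST↣Initial i = μ.segment↣ (proj₂ (proj₂ (height i))) ∘↣ proj₂ LST-segment

        -- The left summand names points of the base model by their positions below `y i`, and these
        -- are to be kept fixed; the right one is the size bound of a `Cover` and names all other
        -- points.
        Name : ∣ κ ∣ₒ → Set
        Name i = Initial i ⊎ (Initial i ⊎ LST)

        Task : Set
        Task = Σ ∣ κ ∣ₒ λ i → Code (Name i)

        code-tower : ∀ i → InTower (Initial i) (Code (Name i))
        code-tower i = tower-power (tower-× (tower-↣ Tag↣LST lst)
          (tower-List (tower-↣ ℕ↣LST lst) (tower-⊎ x (tower-⊎ x lst))))
          where
          x : InTower (Initial i) (Initial i)
          x = 0 , mk↣ id
          lst : InTower (Initial i) LST
          lst = 0 , LST↣Initial i

        task↣ : Task ↣ ∣ μ ∣ₒ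
        task↣ = Σ↣ κ↣μ λ i → tower⇒↣ (segment-≺ (y i)) (code-tower i)

      module WithSuccessor (μ⁺ : Ordinal) (isSuccessor : IsSuccessorCardinal μ μ⁺) where
        open OrdStructures μ strongLimit μ⁺ isSuccessor

        position : ∀ {M} → Dom M → ∣ structure M ∣ ↣ ∣ μ ∣ₒ
        position dom = ↔⇒↣ (dom-size dom)

        -- The points named inj₁ a stand for the a-th elements of M.
        record Realization {M : OrdStr} (dom : Dom M) (t : Task) (Q : OrdStr) : Set (lsuc 0ℓ ⊔ ℓ) where
          field
            model   : Structure τ
            map     : ∣ model ∣ → ∣ structure Q ∣
            map≤    : model ≤ structure Q via map
            name    : ∣ model ∣ → Name (proj₁ t)
            name-injective : Injective _≡_ _≡_ name
            coded   : code model name ≡ proj₂ t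
            fixes   : ∀ {x a} → name x ≡ inj₁ a → ∀ {m} → Injection.to (position dom) m ≡ value a →
                      value (map x) ≡ value m

        module _ {M : OrdStr} (dom : Dom M) where
          private
            h : ∣ structure M ∣ → ∣ μ ∣ₒ
            h = Injection.to (position dom)

          -- `fixes` compares ordinals in `μ⁺` rather than points of `Q`, so passing to a larger
          -- universe leaves it literally the same.
          persistent : ∀ {t Q N} → Q ⊴ N → Realization dom t Q → Realization dom t N
          persistent Q⊴N r = record
            { model = model ; map = include Q⊴N ∘ map ; map≤ = ≤-trans map≤ (proj₂ Q⊴N)
            ; name = name ; name-injective = name-injective ; coded = coded ; fixes = fixes }
            where open Realization r

          open Saturation task↣ (Realization dom) persistent M dom

          abstract
            saturation : Σ OrdStr λ Q → Dom Q × M ⊴ Q × (∀ t → Decided t Q)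
            saturation = saturated

          saturate : OrdStr
          saturate = proj₁ saturation

          saturate-dom : Dom saturate
          saturate-dom = proj₁ (proj₂ saturation)

          saturate-⊴ : M ⊴ saturate
          saturate-⊴ = proj₁ (proj₂ (proj₂ saturation))

          module _ {N : Structure τ} (size : ∣ N ∣ ↔ ∣ μ ∣ₒ)
                   {f : ∣ structure saturate ∣ → ∣ N ∣} (f≤ : structure saturate ≤ N via f)
                   {i : ∣ κ ∣ₒ} {B : Structure τ} {b : ∣ B ∣ → ∣ N ∣} (b≤ : B ≤ N via b)
                   (s : ∣ B ∣ ↣ (Initial i ⊎ LST)) where
            private
              module Real = Realise saturate-dom size f≤

              old : ∣ structure M ∣ → ∣ N ∣
              old m = f (include saturate-⊴ m)

              old-injective : ∀ {m m′} → old m ≡ old m′ → m ≡ m′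
              old-injective eq = value-injective (cong value (injective (≤⇒⊆ f≤) eq))

              Old : ∣ B ∣ → Set
              Old x = ∃[ m ] b x ≡ old m × h m μ.< y i

              name : ∀ x → Dec (Old x) → Name i
              name x (yes (m , _ , p)) = inj₁ (h m ,′ p)
              name x (no _)            = inj₂ (Injection.to s x)

              name-injective : ∀ x x′ d d′ → name x d ≡ name x′ d′ → x ≡ x′
              name-injective x x′ (yes (m , e , _)) (yes (m′ , e′ , _)) eq = injective (≤⇒⊆ b≤)
                (trans e (trans (cong old same-position) (sym e′)))
                where
                same-position : m ≡ m′
                same-position = ↣-injective (position dom) (cong value (inj₁-injective eq))
              name-injective x x′ (no _) (no _) eq = ↣-injective s (inj₂-injective eq)

              name-old : ∀ x m → b x ≡ old m → h m μ.< y i → ∀ d →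
                         ∃[ a ] name x d ≡ inj₁ a × h m ≡ value a
              name-old x m e p (no ¬∃)            = contradiction (m , e , p) ¬∃
              name-old x m e p (yes (m′ , e′ , _)) =
                _ , refl , cong h (old-injective (trans (sym e) e′))

              realise-old : ∀ {x m m′} → b x ≡ old m′ → h m′ ≡ h m → value (Real.realise (b x)) ≡ value m
              realise-old {x} {m} {m′} e hm = begin
                value (Real.realise (b x))    ≡⟨ cong (value ∘ Real.realise) e ⟩
                value (Real.realise (old m′)) ≡⟨ cong value (Real.realise-old (include saturate-⊴ m′)) ⟩
                value m′                      ≡⟨ cong value (↣-injective (position dom) hm) ⟩
                value m                       ∎
                where open ≡-Reasoning

              name-fixes : ∀ x d {a} → name x d ≡ inj₁ a → ∀ {m} → h m ≡ value a →
                           value (Real.realise (b x)) ≡ value m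
              name-fixes x (yes (m′ , e , p)) eq hm =
                realise-old e (trans (cong value (inj₁-injective eq)) (sym hm))

              n : ∣ B ∣ → Name i
              n x = name x em

              n-injective : Injective _≡_ _≡_ n
              n-injective {x} {x′} = name-injective x x′ em em

              realization : Realization dom (i , code B n) Real.realised
              realization = record
                { model = B ; map = Real.realise ∘ b
                ; map≤ = ≤-trans b≤ (isomorphism⇒≤ Real.realise-isomorphism (≤⇒Kʳ b≤))
                ; name = n ; name-injective = n-injective ; coded = refl
                ; fixes = λ {x} → name-fixes x em }

              inside : Realization dom (i , code B n) saturate
              inside = proj₂ (proj₂ (proj₂ saturation)) (i , code B n)
                Real.realised-dom Real.⊴-realised realization

              module In = Realization inside

              abstract
                iso : ∃[ θ ] IsIsomorphism B In.model θ × In.name ∘ θ ≗ n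
                iso = code-isomorphism {R = Name i} B In.model {c = n} {c′ = In.name}
                  n-injective In.name-injective (sym In.coded)

            -- `B` itself realizes the task `(i , code B n)` in the copy of `N` above `saturate`, so
            -- the task is realized in `saturate`; equality of codes identifies `B` with the model
            -- found there.
            fill : ∣ B ∣ → ∣ structure saturate ∣
            fill = In.map ∘ proj₁ iso

            fill≤ : B ≤ structure saturate via fill
            fill≤ = ≤-trans (isomorphism⇒≤ (proj₁ (proj₂ iso)) (≤⇒Kˡ b≤)) In.map≤

            fill-fixes : ∀ x m → b x ≡ f (include saturate-⊴ m) → h m μ.< y i → value (fill x) ≡ value m
            fill-fixes x m e p =
              In.fixes (trans (proj₂ (proj₂ iso) x) (proj₁ (proj₂ named))) (proj₂ (proj₂ named))
              where
              named : ∃[ a ] n x ≡ inj₁ a × h m ≡ value a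
              named = name-old x m e p em

        private
          F-with : (M : OrdStr) → Dec (Dom M) → OrdStr
          F-with M (yes dom) = saturate dom
          F-with M (no _)    = M

        F : OrdStr → OrdStr
        F M = F-with M em

        -- `saturate` depends on the domain proof through the enumeration of `M`. The proof inside
        -- `F` comes from excluded middle, so it is returned with the equation instead of being
        -- compared with the given one.
        F-saturates : ∀ M → Dom M → Σ (Dom M) λ dom → F M ≡ saturate dom
        F-saturates M dom = lemma em
          where
          lemma : ∀ d → Σ (Dom M) λ dom → F-with M d ≡ saturate dom
          lemma (yes dom′) = dom′ , refl
          lemma (no ¬dom)  = contradiction dom ¬dom

        F-extends : ∀ M → Dom M → M ⊴ F M × Dom (F M)
        F-extends M dom with F-saturates M dom
        ... | dom′ , eq = subst (λ Q → M ⊴ Q × Dom Q) (sym eq) (saturate-⊴ dom′ , saturate-dom dom′)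

        module Chain (M : ∣ κ +1 ∣ₒ → OrdStr) (doms : ∀ i → Dom (M i))
                     (isChain : IsChain 𝔨 μ⁺ κ M) (obeys : Obeys 𝔨 μ⁺ κ F M) where
          open IsChain isChain

          private
            module κ+1 = OrdinalProperties (κ +1)

            M∞ : Structure τ
            M∞ = structure (M ⊤⁺)

            lift-suc : ∀ {α β} → IsSuc κ α β → IsSuc (κ +1) [ α ] [ β ]
            lift-suc (α<β , none) = [ α<β ] , λ { [ c ] ([ p ] , [ q ]) → none c (p , q) }

            -- Doubling stays below κ because κ has no last element. The bound `α ≤ β` makes the odd
            -- stages cofinal in the chain.
            double : ∀ α → ∃[ β ] Twice (κ +1) [ α ] [ β ] × α κ.≤ β
            double α = go (κ.wellFounded α)
              where
              go : ∀ {α} → Acc κ._<_ α → ∃[ β ] Twice (κ +1) [ α ] [ β ] × α κ.≤ β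
              go {α} (acc rs) with em {P = ∃[ α′ ] IsSuc κ α′ α}
              ... | no ¬suc = α , zero-or-limit (λ
                    { [ α′ ] ([ p ] , none) → ¬suc (α′ , p , λ c (q , r) → none [ c ] ([ q ] , [ r ])) }) ,
                    κ.<-irrefl
              ... | yes (α′ , isSuc@(α′<α , none)) with go (rs α′<α)
              ...   | β , twice , α′≤β = β″ , successor twice (lift-suc isSuc) (lift-suc β-suc) (lift-suc β′-suc) ,
                      λ β″<α → none β′ (κ.≤-<-trans α′≤β (proj₁ β-suc) , κ.<-trans (proj₁ β′-suc) β″<α)
                where
                β′     = proj₁ (next β)
                β-suc  = proj₂ (next β)
                β″     = proj₁ (next β′)
                β′-suc = proj₂ (next β′)

            odd : ∣ κ ∣ₒ → ∣ κ ∣ₒ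
            odd α = proj₁ (next (proj₁ (double α)))

            even : ∣ κ ∣ₒ → ∣ κ ∣ₒ
            even α = proj₁ (next (odd α))

            α<odd : ∀ α → α κ.< odd α
            α<odd α = κ.≤-<-trans (proj₂ (proj₂ (double α))) (proj₁ (proj₂ (next (proj₁ (double α)))))

            M-even : ∀ α → M [ even α ] ≡ F (M [ odd α ])
            M-even α = obeys α (proj₁ (proj₂ (double α)))
              (lift-suc (proj₂ (next (proj₁ (double α))))) (lift-suc (proj₂ (next (odd α))))

            abstract
              saturated-stage : ∀ α → Σ (Dom (M [ odd α ])) λ dom → saturate dom ⊴ M ⊤⁺
              saturated-stage α = proj₁ saturates ,
                subst (_⊴ M ⊤⁺) (trans (M-even α) (proj₂ saturates)) (increasing [ even α ]<⊤⁺)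
                where
                saturates : Σ (Dom (M [ odd α ])) λ dom → F (M [ odd α ]) ≡ saturate dom
                saturates = F-saturates (M [ odd α ]) (doms [ odd α ])

            dom : ∀ α → Dom (M [ odd α ])
            dom α = proj₁ (saturated-stage α)

            inM∞ : ∀ α → saturate (dom α) ⊴ M ⊤⁺
            inM∞ α = proj₂ (saturated-stage α)

            ⊤⁺-limit : IsLimit ((κ +1) ↓ ⊤⁺)
            ⊤⁺-limit = ([ proj₁ (U.nonempty (U.everywhere {P = λ _ → ⊤} λ _ → tt)) ] ,′ [ _ ]<⊤⁺) , above
              where
              above : ∀ x → ∃[ z ] value {P = κ+1._< ⊤⁺} x κ+1.< value z
              above ([ a ] , _) = ([ proj₁ (next a) ] ,′ [ _ ]<⊤⁺) , [ proj₁ (proj₂ (next a)) ]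
              above (⊤⁺ , p) with () ← member {P = κ+1._< ⊤⁺} (⊤⁺ , p)

            -- Continuity at κ puts `m` into an earlier stage `j`, and almost every `α` is beyond
            -- `j`.
            eventually-old : (m : ∣ M∞ ∣) → U (λ α → Ordinal._<_ μ⁺ (value m) (universe (M [ odd α ])))
            eventually-old m = from-index (continuous ⊤⁺ ⊤⁺-limit (member m))
              where
              from-index : (∃[ i ] i κ+1.< ⊤⁺ × Ordinal._<_ μ⁺ (value m) (universe (M i))) → U _
              from-index ([ j ] , _ , m∈) = U.upward
                (λ {α} j<α → proj₁ (increasing [ κ.<-trans j<α (α<odd α) ]) m∈) (tail j)

            m₀ : ∣ M∞ ∣
            m₀ = Inverse.from (dom-size (doms ⊤⁺)) 0μ

            small-LST : Smallness.Small D-isUltrafilter LST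
            small-LST = D-small (≺⇒small LST≺κ)

            open Ultraproduct D-isUltrafilter small-LST (proj₁ (doms ⊤⁺)) m₀

            module D = Smallness D-isUltrafilter

            module Approximate {N : Structure τ} (kN : K N) (size : ∣ N ∣ ↔ ∣ μ ∣ₒ)
                               {f : ∣ M∞ ∣ → ∣ N ∣} (f≤ : M∞ ≤ N via f) where

              points : ∀ i → Initial i → ∣ N ∣
              points i a = Inverse.from size (value a)

              cover-of : ∀ i → Cover {N = N} (points i)
              cover-of i = LST-cover kN (points i)

              module C (i : ∣ κ ∣ₒ) = Cover (cover-of i)

              stage≤N : ∀ α → structure (saturate (dom α)) ≤ N via (f ∘ include (inM∞ α))
              stage≤N α = ≤-trans (proj₂ (inM∞ α)) f≤

              image : ∀ α i → ∣ C.model i ∣ → ∣ structure (saturate (dom α)) ∣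
              image α i = fill (dom α) size (stage≤N α) {i} (C.inc≤ i) (C.size i)

              covers : ∀ n → D (λ (_ , i) → ∃[ x ] C.inc i x ≡ n)
              covers n = U.everywhere λ _ → U.upward
                (λ {i} p → C.lift i (_ ,′ p) , trans (C.inc-lift i (_ ,′ p)) (Inverse.strictlyInverseʳ size n))
                (y-exceeds (Inverse.to size n))

              approximation : Approximation N
              approximation = record
                { part  = λ (_ , i) → C.model i
                ; incl  = λ (_ , i) → C.inc i
                ; incl≤ = λ (_ , i) → C.inc≤ i
                ; img   = λ (α , i) → include (inM∞ α) ∘ image α i
                ; img≤  = λ (α , i) →
                  ≤-trans (fill≤ (dom α) size (stage≤N α) (C.inc≤ i) (C.size i)) (proj₂ (inM∞ α))
                ; cover = covers }

              open Approximation approximation using (extend; extend-incl)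

              -- For almost every `α` the point `m` is in `M [ odd α ]`; with `α` given, for almost
              -- every `i` its position there is below `y i`, so its name is one of those that
              -- `fill` must fix.
              fixes : ∀ m → D (λ i → extend i (f m) ≡ m)
              fixes m = D.upward (λ {i} (old , x , e) → at i old x e) (D.meet early (covers (f m)))
                where
                Early : ∣ κ ∣ₒ × ∣ κ ∣ₒ → Set
                Early (α , i) = ∃[ m′ ] value m′ ≡ value m × Injection.to (position (dom α)) m′ μ.< y i

                early : D Early
                early = U.upward (λ {α} m∈ → U.upward (λ p → (value m ,′ m∈) , refl , p)
                  (y-exceeds (Injection.to (position (dom α)) (value m ,′ m∈)))) (eventually-old m)

                at : ∀ i → Early i → ∀ x → C.inc (proj₂ i) x ≡ f m → extend i (f m) ≡ m
                at (α , i) (m′ , m′≡m , p) x e = begin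
                  extend (α , i) (f m)                ≡⟨ cong (extend (α , i)) e ⟨
                  extend (α , i) (C.inc i x)          ≡⟨ extend-incl (α , i) x ⟩
                  include (inM∞ α) (image α i x)      ≡⟨ value-injective (trans fixed m′≡m) ⟩
                  m                                   ∎
                  where
                  open ≡-Reasoning
                  fixed : value (image α i x) ≡ value m′
                  fixed = fill-fixes (dom α) size (stage≤N α) (C.inc≤ i) (C.size i) x m′
                    (trans e (cong f (value-injective (sym m′≡m)))) p

          private
            module Pair (N : Bool → Structure τ) (kN : ∀ l → K (N l)) (size : ∀ l → ∣ N l ∣ ↔ ∣ μ ∣ₒ)
                        (f : ∀ l → ∣ M∞ ∣ → ∣ N l ∣) (f≤ : ∀ l → M∞ ≤ N l via f l) where

              approx : ∀ l → Approximation (N l)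
              approx l = Approximate.approximation (kN l) (size l) (f≤ l)

              amalgamated : Σ (Structure τ) λ P → Σ (∀ l → ∣ N l ∣ → ∣ P ∣) λ g →
                            (∀ l → N l ≤ P via g l) × (∀ l l′ m → g l (f l m) ≡ g l′ (f l′ m))
              amalgamated = _ , _ , proj₁ (proj₂ (proj₂ amalgam)) , λ l l′ m →
                proj₂ (proj₂ (proj₂ amalgam))
                (D.upward (λ (p , q) → trans p (sym q))
                  (D.meet (Approximate.fixes (kN l) (size l) (f≤ l) m)
                          (Approximate.fixes (kN l′) (size l′) (f≤ l′) m)))
                where
                amalgam = Amalgam.amalgamation N kN approx μ 0μ (λ l → Inverse.from (size l))
                  (λ l n → Inverse.to (size l) n , Inverse.strictlyInverseʳ (size l) n)

          isAmalgamationBase : IsAmalgamationBase 𝔨 μ M∞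
          isAmalgamationBase = (proj₁ (doms ⊤⁺) , dom-size (doms ⊤⁺)) ,
            λ M₁ M₂ f₁ f₂ (k₁ , s₁) (k₂ , s₂) le₁ le₂ →
            let (P , g , g≤ , commute) = Pair.amalgamated
                  (λ { true → M₁ ; false → M₂ }) (λ { true → k₁ ; false → k₂ })
                  (λ { true → s₁ ; false → s₂ })
                  (λ { true → f₁ ; false → f₂ }) (λ { true → le₁ ; false → le₂ })
            in P , g true ∘ f₁ , g true , g false , ≤-trans le₁ (g≤ true) ,
               g≤ true , (λ _ → refl) , g≤ false , commute false true

      hasAmalgamationBases : HasAmalgamationBases 𝔨 μ κ
      hasAmalgamationBases μ⁺ isSuccessor = F , F-extends , Chain.isAmalgamationBase
        where open WithSuccessor μ⁺ isSuccessor

claim1p11 : (∀ {a} → ExcludedMiddle a) →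
    (∀ {a b} → Extensionality a b) →
    ∀ {τ : Vocabulary} {ℓ : Level} (𝔨 : AEC τ ℓ) (μ κ : Ordinal) →
    IsStrongLimit μ →
    IsCofinality κ μ →
    AEC.LST 𝔨 ≺ ∣ κ ∣ₒ →
    IsMeasurable κ →
    HasAmalgamationBases 𝔨 μ κ
claim1p11 em ext 𝔨 μ κ = Proof.Main.hasAmalgamationBases em ext 𝔨 μ κ
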